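{- There exists a function $f:\mathbb{N}\times\mathbb{N}\to\mathbb{N}$ such that for every integer $\ell\ge 0$, every integer $d\ge 0$ and every graph $G$ of distance VC-dimension $d$, the vertex set of $G$ can be covered by $f(\nu_\ell,d)$ balls of radius $\ell$; that is, $\tau_\ell\le f(\nu_\ell,d)$, where $\tau_\ell$ and $\nu_\ell$ are the transversality and the packing number of the $B_\ell$-hypergraph of $G$.
   Context: All graphs are finite and simple; $d_G$ is shortest-path distance ($+\infty$ between components) and $B_G(x,k)=\{y: d_G(x,y)\le k\}$. The $B_\ell$-hypergraph of $G=(V,E)$ has vertex set $V$ and one hyperedge $B_G(v,\ell)$ per $v\in V$; the $B$-hypergraph has hyperedges all balls $B_G(v,k)$, $v\in V$, $k\ge 0$. A set $X$ is shattered by a hypergraph if for every $X'\subseteq X$ there is a hyperedge $e$ with $e\cap X=X'$; the VC-dimension is the maximum size of a shattered set. The distance VC-dimension of $G$ is the maximum over all induced subgraphs $G'$ of $G$ of the VC-dimension of the $B$-hypergraph of $G'$. The transversality $\tau$ of a hypergraph is the minimum size of a set of vertices meeting every hyperedge; the packing number $\nu$ is the maximum number of pairwise disjoint hyperedges. (A hitting set of the $B_\ell$-hypergraph is the same as a set $X$ such that every vertex is at distance at most $\ell$ from $X$.) -}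

module Defs where

open import Data.Nat using (ℕ; zero; suc; _≤_)
open import Data.Bool using (Bool; true; false)
open import Data.Fin using (Fin)
open import Data.Fin.Subset using (Subset; _∈_; _∉_; _⊆_; ⊤; ∣_∣)
open import Data.Product using (Σ; ∃; _×_; _,_)
open import Relation.Binary.PropositionalEquality using (_≡_; _≢_)
open import Relation.Nullary using (¬_)

record Graph : Set where
  field
    n      : ℕ
    adj    : Fin n → Fin n → Bool
    sym    : ∀ x y → adj x y ≡ adj y x
    irrefl : ∀ x → adj x x ≡ false
open Graph public

data Walk (G : Graph) (S : Subset (n G)) : Fin (n G) → Fin (n G) → ℕ → Set where
  here : ∀ {x} → x ∈ S → Walk G S x x zero
  step : ∀ {x y z k} → x ∈ S → adj G x y ≡ true → Walk G S y z k → Walk G S x z (suc k)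

-- y ∈ B_{G[S]}(v, k), i.e. d_{G[S]}(v, y) ≤ k  (distance = minimal walk length;
-- infinite between components, so no walk exists).
InBall : (G : Graph) → Subset (n G) → Fin (n G) → ℕ → Fin (n G) → Set
InBall G S v k y = Σ ℕ λ m → m ≤ k × Walk G S v y m

Shattered : (G : Graph) → Subset (n G) → Subset (n G) → Set
Shattered G S X =
  X ⊆ S ×
  (∀ (X' : Subset (n G)) → X' ⊆ X →
     Σ (Fin (n G)) λ v → Σ ℕ λ k → v ∈ S ×
       (∀ x → x ∈ X → (InBall G S v k x → x ∈ X') × (x ∈ X' → InBall G S v k x)))

-- The distance VC-dimension of G equals d: the maximum, over induced subgraphs
-- G[S], of the VC-dimension of the B-hypergraph of G[S], is d.
DistVCDim : Graph → ℕ → Set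
DistVCDim G d =
  (Σ (Subset (n G)) λ S → Σ (Subset (n G)) λ X → Shattered G S X × ∣ X ∣ ≡ d) ×
  (∀ (S X : Subset (n G)) → Shattered G S X → ∣ X ∣ ≤ d)

Ball : (G : Graph) → ℕ → Fin (n G) → Fin (n G) → Set
Ball G ℓ v y = InBall G ⊤ v ℓ y

Packing : (G : Graph) → ℕ → Subset (n G) → Set
Packing G ℓ C = ∀ u v → u ∈ C → v ∈ C → u ≢ v →
  ∀ y → ¬ (Ball G ℓ u y × Ball G ℓ v y)

PackingNumber : (G : Graph) → ℕ → ℕ → Set
PackingNumber G ℓ p =
  (Σ (Subset (n G)) λ C → Packing G ℓ C × ∣ C ∣ ≡ p) ×
  (∀ C → Packing G ℓ C → ∣ C ∣ ≤ p)

Transversal : (G : Graph) → ℕ → Subset (n G) → Set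
Transversal G ℓ X = ∀ v → Σ (Fin (n G)) λ x → x ∈ X × Ball G ℓ v x

{-# OPTIONS --safe #-}
module Submission where

-- By truncating distances at 2ℓ + 1 all metric conditions become inequalities in ℕ.
--
-- (1) Fix weights on the centres.  If every vertex lay in few balls (by weight), then in
-- a random sample of centres the midpoints of x_i and x_j would avoid all other balls
-- B(x_k, ℓ).  By Ramsey's theorem either many of these balls are disjoint, against ν, or
-- many centres have pairwise distances all < 2ℓ or all = 2ℓ.  In the latter case split
-- the centres into x_a and x_b and let S consist of the geodesics (through the chosen
-- midpoints) of the pairs {a, b} with a ∈ b, where b runs over the subsets of the a's.
-- The midpoint condition forbids shortcuts, so in G[S] the ball of radius 2ℓ about x_b
-- contains x_a only if a ∈ b, against the bound on the distance VC-dimension.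
--
-- (2) Hence some vertex always lies in a constant fraction of the weighted balls, and
-- multiplicative weights (in place of LP duality) yield a sequence of vertices of
-- which every ball contains a constant fraction.
--
-- (3) An ε-net for this sequence is a hitting set.  Choose greedily balls e_1, e_2, …, such
-- that no e_j has almost all its mass in a later one; by Sauer–Shelah boundedly many
-- suffice, and the balls that contain almost all of e_j are hit by d + 1 points.

open import Defs renaming (sym to adj-sym)
open import Data.Bool using (Bool; true; false; not; _∧_; _∨_; _xor_; if_then_else_)
import Data.Bool.Properties as Bool
import Data.Empty as Empty
open import Data.Fin using (Fin; zero; suc; toℕ; join; splitAt; combine; remQuot; finToFun; funToFin)
import Data.Fin.Properties as Fin
open import Data.Fin.Subset using (Subset; _∈_; _⊆_; ⊤; ⊥; ∣_∣; ⁅_⁆; _∪_; _-_)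
open import Data.Fin.Subset.Properties using (∈⊤; ∣⊥∣≡0; ∣⁅x⁆∣≡1; x∈⁅x⁆; x∈p∪q⁺; p⊆q⇒∣p∣≤∣q∣; x∈p⇒∣p-x∣<∣p∣; x∈p∧x≢y⇒x∈p-y; _∈?_)
open import Data.List as List using (List; []; _∷_; length; filter; allFin)
open import Data.List.Membership.Propositional using () renaming (_∈_ to _∈ˡ_)
open import Data.List.Membership.Propositional.Properties using (∈-filter⁻; ∈-lookup)
open import Data.List.Properties using (length-tabulate)
open import Data.List.Relation.Unary.All as All using (All)
open import Data.List.Relation.Unary.AllPairs as AllPairs using (AllPairs)
import Data.List.Relation.Unary.AllPairs.Properties as AllPairs
import Data.List.Relation.Unary.Any as Any
import Data.List.Relation.Unary.Unique.Propositional.Properties as Unique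
open import Data.Nat
open import Data.Nat.Properties
open import Data.Nat.Tactic.RingSolver using (solve)
open import Data.Product using (Σ; ∃; _×_; _,_; proj₁; proj₂)
open import Data.Sum using (_⊎_; inj₁; inj₂; [_,_]′)
import Data.Sum.Properties as Sum
open import Data.Vec as Vec using (Vec; lookup; _[_]≔_)
import Data.Vec.Properties as Vec
open import Function using (_∘_; id)
open import Relation.Binary.Definitions using (tri<; tri≈; tri>)
open import Relation.Binary.PropositionalEquality hiding (J)
open import Relation.Nullary using (¬_; Dec; yes; no; does; contradiction)
open import Relation.Nullary.Decidable using (dec-true; _×-dec_; _⊎-dec_; _→-dec_; ¬?; map′)
import Algebra.Properties.Semiring.Sum
open Algebra.Properties.Semiring.Sum +-*-semiring using (sum; sum-cong-≗; ∑-distrib-+; ∑-comm; *-distribˡ-sum; *-distribʳ-sum)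

-- Inequalities and finite sums of natural numbers

-- Linear inequalities are proved from certificates: add up hypotheses, and let
-- the ring solver check that the sum differs from the goal by a slack k.
certify : ∀ {l r x y} k → l ≤ r → l + y ≡ r + x + k → x ≤ y
certify {l} {r} {x} {y} k l≤r eq = +-cancelˡ-≤ r x y
  (≤-trans (m≤m+n (r + x) k) (≤-trans (≤-reflexive (sym eq)) (+-monoˡ-≤ y l≤r)))

infixr 5 _⊞_
_⊞_ : ∀ {a b c d} → a ≤ b → c ≤ d → a + c ≤ b + d
_⊞_ = +-mono-≤

x*yz≡y*xz : ∀ x y z → x * (y * z) ≡ y * (x * z)
x*yz≡y*xz x y z = solve (x ∷ y ∷ z ∷ [])

ind : Bool → ℕ
ind true  = 1
ind false = 0

ind-not : ∀ b → ind b + ind (not b) ≡ 1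
ind-not true  = refl
ind-not false = refl

sum-mono : ∀ {n} {f g : Fin n → ℕ} → (∀ i → f i ≤ g i) → sum f ≤ sum g
sum-mono {zero}  f≤g = z≤n
sum-mono {suc n} f≤g = +-mono-≤ (f≤g zero) (sum-mono (f≤g ∘ suc))

sum-const : ∀ n c → sum {n} (λ _ → c) ≡ n * c
sum-const zero    c = refl
sum-const (suc n) c = cong (c +_) (sum-const n c)

term≤sum : ∀ {n} (f : Fin n → ℕ) i → f i ≤ sum f
term≤sum f zero    = m≤m+n _ _
term≤sum f (suc i) = ≤-trans (term≤sum (f ∘ suc) i) (m≤n+m _ _)

sum<⇒∃< : ∀ {n} (f g : Fin n → ℕ) → sum f < sum g → ∃ λ i → f i < g i
sum<⇒∃< {zero}  f g ()
sum<⇒∃< {suc n} f g lt with f zero <? g zero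
... | yes p = zero , p
... | no ¬p with sum (f ∘ suc) <? sum (g ∘ suc)
...   | yes q = let i , r = sum<⇒∃< (f ∘ suc) (g ∘ suc) q in suc i , r
...   | no ¬q = contradiction lt (≤⇒≯ (+-mono-≤ (≮⇒≥ ¬p) (≮⇒≥ ¬q)))

-- Comparing `f` with `suc ∘ g` makes the hypothesis strict, because the index set is nonempty.
sum≤⇒∃≤ : ∀ {n} (f g : Fin (suc n) → ℕ) → sum f ≤ sum g → ∃ λ i → f i ≤ g i
sum≤⇒∃≤ f g le =
  let i , r = sum<⇒∃< f (suc ∘ g) (≤-<-trans le (s≤s (+-monoʳ-≤ (g zero) (sum-mono {_} {g ∘ suc} {suc ∘ g ∘ suc} (λ i → n≤1+n _)))))
  in i , s≤s⁻¹ r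

-- Expectations over random tuples and the union bound

-- A weighted sum over all N-tuples: up to the normalisation (sum w) ^ N, the
-- expectation of F at N independent points of distribution w.
module _ {n : ℕ} (w : Fin n → ℕ) where

  𝔼 : ∀ N → (Vec (Fin n) N → ℕ) → ℕ
  𝔼 zero    F = F Vec.[]
  𝔼 (suc N) F = sum λ u → w u * 𝔼 N λ v → F (u Vec.∷ v)

  𝔼-mono : ∀ N {F G} → (∀ v → F v ≤ G v) → 𝔼 N F ≤ 𝔼 N G
  𝔼-mono zero    F≤G = F≤G Vec.[]
  𝔼-mono (suc N) F≤G = sum-mono λ u → *-monoʳ-≤ (w u) (𝔼-mono N λ v → F≤G (u Vec.∷ v))

  𝔼-cong : ∀ N {F G} → (∀ v → F v ≡ G v) → 𝔼 N F ≡ 𝔼 N G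
  𝔼-cong zero    F≡G = F≡G Vec.[]
  𝔼-cong (suc N) F≡G = sum-cong-≗ λ u → cong (w u *_) (𝔼-cong N λ v → F≡G (u Vec.∷ v))

  𝔼-const : ∀ N c → 𝔼 N (λ _ → c) ≡ c * sum w ^ N
  𝔼-const zero    c = sym (*-identityʳ c)
  𝔼-const (suc N) c = begin
    sum (λ u → w u * 𝔼 N (λ _ → c))  ≡⟨ *-distribʳ-sum (𝔼 N (λ _ → c)) w ⟨
    sum w * 𝔼 N (λ _ → c)            ≡⟨ cong (sum w *_) (𝔼-const N c) ⟩
    sum w * (c * sum w ^ N)          ≡⟨ *-assoc (sum w) c _ ⟨
    sum w * c * sum w ^ N            ≡⟨ cong (_* sum w ^ N) (*-comm (sum w) c) ⟩
    c * sum w * sum w ^ N            ≡⟨ *-assoc c _ _ ⟩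
    c * (sum w * sum w ^ N)          ∎
    where open ≡-Reasoning

  𝔼-* : ∀ N c F → 𝔼 N (λ v → c * F v) ≡ c * 𝔼 N F
  𝔼-* zero    c F = refl
  𝔼-* (suc N) c F = begin
    sum (λ u → w u * 𝔼 N (λ v → c * F (u Vec.∷ v)))
      ≡⟨ sum-cong-≗ (λ u → trans (cong (w u *_) (𝔼-* N c (λ v → F (u Vec.∷ v)))) (x*yz≡y*xz (w u) c _)) ⟩
    sum (λ u → c * (w u * 𝔼 N (λ v → F (u Vec.∷ v))))
      ≡⟨ *-distribˡ-sum c (λ u → w u * 𝔼 N (λ v → F (u Vec.∷ v))) ⟨
    c * 𝔼 (suc N) F ∎
    where open ≡-Reasoning

  𝔼-sum : ∀ N {m} (F : Fin m → Vec (Fin n) N → ℕ) → 𝔼 N (λ v → sum λ i → F i v) ≡ sum λ i → 𝔼 N (F i)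
  𝔼-sum zero    F = refl
  𝔼-sum (suc N) F = begin
    sum (λ u → w u * 𝔼 N (λ v → sum λ i → F i (u Vec.∷ v)))
      ≡⟨ sum-cong-≗ (λ u → trans (cong (w u *_) (𝔼-sum N (λ i v → F i (u Vec.∷ v)))) (*-distribˡ-sum (w u) (λ i → 𝔼 N (λ v → F i (u Vec.∷ v))))) ⟩
    sum (λ u → sum λ i → w u * 𝔼 N (λ v → F i (u Vec.∷ v)))
      ≡⟨ ∑-comm (λ u i → w u * 𝔼 N (λ v → F i (u Vec.∷ v))) ⟩
    sum (λ i → 𝔼 (suc N) (F i)) ∎
    where open ≡-Reasoning

  -- Method of conditional expectations: the coordinates are fixed one after another, and strictness
  -- rules out a coordinate of weight zero.
  𝔼<⇒∃< : ∀ N F G → 𝔼 N F < 𝔼 N G → ∃ λ v → F v < G v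
  𝔼<⇒∃< zero    F G lt = Vec.[] , lt
  𝔼<⇒∃< (suc N) F G lt =
    let u , lt-u = sum<⇒∃< (λ u → w u * 𝔼 N (λ v → F (u Vec.∷ v))) (λ u → w u * 𝔼 N (λ v → G (u Vec.∷ v))) lt
        v , lt-v = 𝔼<⇒∃< N (λ v → F (u Vec.∷ v)) (λ v → G (u Vec.∷ v)) (*-cancelˡ-< (w u) _ _ lt-u)
    in u Vec.∷ v , lt-v

  module _ (Q N : ℕ) where

    -- The expectation of `F` is at most t / Q, cleared of denominators.
    Rare : ℕ → (Vec (Fin n) N → ℕ) → Set
    Rare t F = Q * 𝔼 N F ≤ t * sum w ^ N

    rare-sum : ∀ {m t} (F : Fin m → Vec (Fin n) N → ℕ) → (∀ i → Rare t (F i)) → Rare (m * t) (λ v → sum λ i → F i v)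
    rare-sum {m} {t} F rare = begin
      Q * 𝔼 N (λ v → sum λ i → F i v)   ≡⟨ cong (Q *_) (𝔼-sum N F) ⟩
      Q * sum (λ i → 𝔼 N (F i))         ≡⟨ *-distribˡ-sum Q (λ i → 𝔼 N (F i)) ⟩
      sum (λ i → Q * 𝔼 N (F i))         ≤⟨ sum-mono rare ⟩
      sum {m} (λ i → t * sum w ^ N)     ≡⟨ sum-const m _ ⟩
      m * (t * sum w ^ N)               ≡⟨ *-assoc m t _ ⟨
      m * t * sum w ^ N                 ∎
      where open ≤-Reasoning

    -- First moment method: an expectation below 1 forces a function with values in ℕ to vanish
    -- somewhere.
    rare-avoid : ∀ {t F} → 0 < sum w → t < Q → Rare t F → ∃ λ v → F v ≡ 0
    rare-avoid {t} {F} W>0 t<Q rare = let v , lt = 𝔼<⇒∃< N F (λ _ → 1) small in v , n<1⇒n≡0 lt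
      where
      open ≤-Reasoning
      instance
        _ : NonZero (sum w)
        _ = >-nonZero W>0
        _ : NonZero (sum w ^ N)
        _ = m^n≢0 (sum w) N
      small : 𝔼 N F < 𝔼 N (λ _ → 1)
      small = *-cancelˡ-< Q _ _ (begin-strict
        Q * 𝔼 N F          ≤⟨ rare ⟩
        t * sum w ^ N      <⟨ *-monoˡ-< (sum w ^ N) t<Q ⟩
        Q * sum w ^ N      ≡⟨ cong (Q *_) (trans (𝔼-const N 1) (*-identityˡ _)) ⟨
        Q * 𝔼 N (λ _ → 1)  ∎)

-- Condition on all coordinates but the `k`-th: the hypothesis bounds every conditional expectation
-- by 1 / Q, and averaging preserves this.
rare-coordinate : ∀ {n} (w : Fin n → ℕ) Q N (k : Fin N) (F : Vec (Fin n) N → ℕ) →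
  (∀ v → Q * sum (λ u → w u * F (v [ k ]≔ u)) ≤ sum w) → Rare w Q N 1 F
rare-coordinate {zero}  w Q (suc N) zero F rare = ≤-trans (≤-reflexive (*-zeroʳ Q)) z≤n
rare-coordinate {suc _} w Q (suc N) zero F rare = begin
  Q * sum (λ u → w u * 𝔼 w N (λ v → F (u Vec.∷ v)))
    ≡⟨ cong (Q *_) (sum-cong-≗ (λ u → sym (𝔼-* w N (w u) (λ v → F (u Vec.∷ v))))) ⟩
  Q * sum (λ u → 𝔼 w N (λ v → w u * F (u Vec.∷ v)))
    ≡⟨ cong (Q *_) (𝔼-sum w N (λ u v → w u * F (u Vec.∷ v))) ⟨
  Q * 𝔼 w N (λ v → sum λ u → w u * F (u Vec.∷ v))
    ≡⟨ 𝔼-* w N Q _ ⟨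
  𝔼 w N (λ v → Q * sum λ u → w u * F (u Vec.∷ v))
    -- The head `zero` is a placeholder, overwritten by the update in `rare`.
    ≤⟨ 𝔼-mono w N (λ v → rare (zero Vec.∷ v)) ⟩
  𝔼 w N (λ v → sum w)
    ≡⟨ trans (𝔼-const w N (sum w)) (sym (*-identityˡ _)) ⟩
  1 * sum w ^ suc N ∎
  where open ≤-Reasoning
rare-coordinate w Q (suc N) (suc k) F rare = begin
  Q * sum (λ u → w u * 𝔼 w N (λ v → F (u Vec.∷ v)))
    ≡⟨ *-distribˡ-sum Q (λ u → w u * 𝔼 w N (λ v → F (u Vec.∷ v))) ⟩
  sum (λ u → Q * (w u * 𝔼 w N (λ v → F (u Vec.∷ v))))
    ≡⟨ sum-cong-≗ (λ u → x*yz≡y*xz Q (w u) _) ⟩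
  sum (λ u → w u * (Q * 𝔼 w N (λ v → F (u Vec.∷ v))))
    ≤⟨ sum-mono (λ u → *-monoʳ-≤ (w u) (≤-trans (rare-coordinate w Q N k _ (λ v → rare (u Vec.∷ v))) (≤-reflexive (*-identityˡ _)))) ⟩
  sum (λ u → w u * sum w ^ N)
    ≡⟨ *-distribʳ-sum (sum w ^ N) w ⟨
  sum w * sum w ^ N
    ≡⟨ *-identityˡ _ ⟨
  1 * sum w ^ suc N ∎
  where
  open ≤-Reasoning

-- Estimates for powers

n<2^n : ∀ n → n < 2 ^ n
n<2^n zero    = s≤s z≤n
n<2^n (suc n) = certify 0 (n<2^n n ⊞ m^n>0 2 n) (lemma n (2 ^ n))
  where
  lemma : ∀ n p → suc n + 1 + 2 * p ≡ p + p + suc (suc n) + 0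
  lemma n p = solve (n ∷ p ∷ [])

-- The linear part of the binomial expansion of (q + 1) ^ (k + 1).
bernoulli : ∀ q k → q ^ suc k + suc k * q ^ k ≤ suc q ^ suc k
bernoulli q zero    = ≤-reflexive (trans (+-comm (q * 1) 1) refl)
bernoulli q (suc k) = begin
  q ^ suc (suc k) + suc (suc k) * q ^ suc k              ≤⟨ m≤m+n _ (suc k * q ^ k) ⟩
  q ^ suc (suc k) + suc (suc k) * q ^ suc k + suc k * q ^ k  ≡⟨ lemma q k (q ^ k) ⟩
  suc q * (q ^ suc k + suc k * q ^ k)                    ≤⟨ *-monoʳ-≤ (suc q) (bernoulli q k) ⟩
  suc q ^ suc (suc k)                                    ∎
  where
  open ≤-Reasoning
  lemma : ∀ q k p → q * (q * p) + suc (suc k) * (q * p) + suc k * p ≡ suc q * (q * p + suc k * p)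
  lemma q k p = solve (q ∷ k ∷ p ∷ [])

^-distribʳ-* : ∀ m n o → (m * n) ^ o ≡ m ^ o * n ^ o
^-distribʳ-* m n zero    = refl
^-distribʳ-* m n (suc o) = trans (cong (m * n *_) (^-distribʳ-* m n o)) (lemma m n (m ^ o) (n ^ o))
  where
  lemma : ∀ m n p q → m * n * (p * q) ≡ m * p * (n * q)
  lemma m n p q = solve (m ∷ n ∷ p ∷ q ∷ [])

-- The s-th power of (1 + 1/q) ^ (q + 1) ≥ 2, which follows from `bernoulli`.
doubling : ∀ q s → 2 ^ s * q ^ (suc q * s) ≤ suc q ^ (suc q * s)
doubling q s = begin
  2 ^ s * q ^ (suc q * s)    ≡⟨ cong (2 ^ s *_) (^-*-assoc q (suc q) s) ⟨
  2 ^ s * (q ^ suc q) ^ s    ≡⟨ ^-distribʳ-* 2 (q ^ suc q) s ⟨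
  (2 * q ^ suc q) ^ s        ≤⟨ ^-monoˡ-≤ s base ⟩
  (suc q ^ suc q) ^ s        ≡⟨ ^-*-assoc (suc q) (suc q) s ⟩
  suc q ^ (suc q * s)        ∎
  where
  open ≤-Reasoning
  lemma : ∀ q p → 2 * (q * p) + p ≡ q * p + suc q * p
  lemma q p = solve (q ∷ p ∷ [])
  base : 2 * q ^ suc q ≤ suc q ^ suc q
  base = ≤-trans (≤-trans (m≤m+n _ (q ^ q)) (≤-reflexive (lemma q (q ^ q)))) (bernoulli q q)

linear<exp : ∀ C → ∃ λ u → C * suc u < 2 ^ u
linear<exp C = a + a , (begin-strict
  C * suc (a + a)        <⟨ certify (C + a) (≤-refl {0}) (lemma C) ⟩
  suc a * suc a          ≤⟨ *-mono-≤ (n<2^n a) (n<2^n a) ⟩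
  2 ^ a * 2 ^ a          ≡⟨ ^-distribˡ-+-* 2 a a ⟨
  2 ^ (a + a)            ∎)
  where
  open ≤-Reasoning
  a : ℕ
  a = 2 * C
  lemma : ∀ C → 0 + suc (2 * C) * suc (2 * C) ≡ 0 + suc (C * suc (2 * C + 2 * C)) + (C + 2 * C)
  lemma C = solve (C ∷ [])

-- For t = u (d + 1) the claim follows from the (d + 1)-st power of a linear estimate in u. Raising
-- the exponent from d to d + 1 needs a nonzero base, hence the separate case c = 0.
polynomial<exp : ∀ c d → ∃ λ t → (c * suc t) ^ d < 2 ^ t
polynomial<exp zero    zero    = 1 , ≤-refl
polynomial<exp zero    (suc d) = 0 , ≤-refl
polynomial<exp c@(suc _) d =
  let u , lt = linear<exp (c * suc d)
  in u * suc d , (begin-strict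
  (c * suc (u * suc d)) ^ d            ≤⟨ ^-monoʳ-≤ (c * suc (u * suc d)) (n≤1+n d) ⟩
  (c * suc (u * suc d)) ^ suc d        ≤⟨ ^-monoˡ-≤ (suc d) (certify (c * d) (≤-refl {0}) (lemma c u d)) ⟩
  (c * suc d * suc u) ^ suc d          <⟨ ^-monoˡ-< (suc d) lt ⟩
  (2 ^ u) ^ suc d                      ≡⟨ ^-*-assoc 2 u (suc d) ⟩
  2 ^ (u * suc d)                      ∎)
  where
  open ≤-Reasoning
  lemma : ∀ c u d → 0 + c * suc d * suc u ≡ 0 + c * suc (u * suc d) + c * d
  lemma c u d = solve (c ∷ u ∷ d ∷ [])

-- The Sauer-Shelah lemma

count : ∀ m → (Vec Bool m → Bool) → ℕ
count zero    F = ind (F Vec.[])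
count (suc m) F = count m (λ v → F (false Vec.∷ v)) + count m (λ v → F (true Vec.∷ v))

ind-∨-∧ : ∀ a b → ind a + ind b ≡ ind (a ∨ b) + ind (a ∧ b)
ind-∨-∧ true  b = refl
ind-∨-∧ false b = sym (+-identityʳ (ind b))

count-∨-∧ : ∀ m F G → count m F + count m G ≡ count m (λ v → F v ∨ G v) + count m (λ v → F v ∧ G v)
count-∨-∧ zero    F G = ind-∨-∧ (F Vec.[]) (G Vec.[])
count-∨-∧ (suc m) F G = begin
  a + b + (c + d)      ≡⟨ interchange a b c d ⟩
  (a + c) + (b + d)    ≡⟨ cong₂ _+_ (count-∨-∧ m _ _) (count-∨-∧ m _ _) ⟩
  (e + f) + (g + h)    ≡⟨ interchange e f g h ⟩
  (e + g) + (f + h)    ∎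
  where
  open ≡-Reasoning
  interchange : ∀ a b c d → a + b + (c + d) ≡ (a + c) + (b + d)
  interchange a b c d = solve (a ∷ b ∷ c ∷ d ∷ [])
  a = count m (λ v → F (false Vec.∷ v))
  b = count m (λ v → F (true Vec.∷ v))
  c = count m (λ v → G (false Vec.∷ v))
  d = count m (λ v → G (true Vec.∷ v))
  e = count m (λ v → F (false Vec.∷ v) ∨ G (false Vec.∷ v))
  f = count m (λ v → F (false Vec.∷ v) ∧ G (false Vec.∷ v))
  g = count m (λ v → F (true Vec.∷ v) ∨ G (true Vec.∷ v))
  h = count m (λ v → F (true Vec.∷ v) ∧ G (true Vec.∷ v))

∨-true : ∀ a b → a ∨ b ≡ true → a ≡ true ⊎ b ≡ true
∨-true true  b eq = inj₁ refl
∨-true false b eq = inj₂ eq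

∧-true : ∀ a b → a ∧ b ≡ true → a ≡ true × b ≡ true
∧-true true b eq = refl , eq

count>0⇒∃ : ∀ m F → 0 < count m F → ∃ λ v → F v ≡ true
count>0⇒∃ zero F pos with F Vec.[] in eq
... | true  = Vec.[] , eq
count>0⇒∃ (suc m) F pos with count m (λ v → F (false Vec.∷ v)) in eq
... | suc _ = let v , Fv = count>0⇒∃ m _ (subst (0 <_) (sym eq) (s≤s z≤n)) in false Vec.∷ v , Fv
... | zero  = let v , Fv = count>0⇒∃ m _ pos in true Vec.∷ v , Fv

-- The sum of the binomial coefficients of m over all i < k, computed by Pascal's rule.
sauerBound : ℕ → ℕ → ℕ
sauerBound m       zero    = 0
sauerBound zero    (suc k) = 1
sauerBound (suc m) (suc k) = sauerBound m (suc k) + sauerBound m k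

sauerBound≤ : ∀ m d → sauerBound m (suc d) ≤ suc m ^ d
sauerBound≤ zero    d       = ≤-reflexive (sym (^-zeroˡ d))
sauerBound≤ (suc m) zero    = ≤-trans (≤-reflexive (+-identityʳ _)) (sauerBound≤ m 0)
sauerBound≤ (suc m) (suc d) = begin
  sauerBound m (suc (suc d)) + sauerBound m (suc d)  ≤⟨ +-mono-≤ (sauerBound≤ m (suc d)) (sauerBound≤ m d) ⟩
  suc m * suc m ^ d + suc m ^ d                      ≡⟨ +-comm (suc m * suc m ^ d) _ ⟩
  suc (suc m) * suc m ^ d                            ≤⟨ *-monoʳ-≤ (suc (suc m)) (^-monoˡ-≤ d (n≤1+n (suc m))) ⟩
  suc (suc m) ^ suc d                                ∎
  where open ≤-Reasoning

-- Split by the first bit. The tails that extend in some way and those that extend in both ways have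
-- the same total count as `F`. If the former are too many, they shatter enough points; otherwise
-- the latter shatter k - 1 points, to which the first coordinate can be added.
sauer : ∀ m k F → sauerBound m k < count m F →
  ∃ λ (y : Fin k → Fin m) → ∀ (b : Fin k → Bool) → ∃ λ v → F v ≡ true × (∀ i → lookup v (y i) ≡ b i)
sauer m zero F lt = (λ ()) , λ b → let v , Fv = count>0⇒∃ m F lt in v , Fv , λ ()
sauer zero (suc k) F lt with F Vec.[]
sauer zero (suc k) F (s≤s ()) | true
sauer zero (suc k) F () | false
sauer (suc m) (suc k) F lt with sauerBound m (suc k) <? count m (λ v → F (false Vec.∷ v) ∨ F (true Vec.∷ v))
... | yes lt∪ = suc ∘ proj₁ shattered , realize∪
  where
  shattered = sauer m (suc k) _ lt∪
  realize∪ : ∀ b → ∃ λ v → F v ≡ true × (∀ i → lookup v (suc (proj₁ shattered i)) ≡ b i)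
  realize∪ b with proj₂ shattered b
  ... | v , Fv , eqs with ∨-true (F (false Vec.∷ v)) _ Fv
  ...   | inj₁ F₀ = false Vec.∷ v , F₀ , eqs
  ...   | inj₂ F₁ = true Vec.∷ v , F₁ , eqs
... | no ≮∪ = y , realize∩
  where
  F₀ F₁ : Vec Bool m → Bool
  F₀ v = F (false Vec.∷ v)
  F₁ v = F (true Vec.∷ v)
  lt∩ : sauerBound m k < count m (λ v → F₀ v ∧ F₁ v)
  lt∩ = +-cancelˡ-< (sauerBound m (suc k)) _ _ (≤-trans lt (≤-trans (≤-reflexive (count-∨-∧ m F₀ F₁)) (+-monoˡ-≤ _ (≮⇒≥ ≮∪))))
  shattered = sauer m k _ lt∩
  y : Fin (suc k) → Fin (suc m)
  y zero    = zero
  y (suc i) = suc (proj₁ shattered i)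
  realize∩ : ∀ b → ∃ λ v → F v ≡ true × (∀ i → lookup v (y i) ≡ b i)
  realize∩ b with proj₂ shattered (b ∘ suc)
  ... | v , Fv , eqs with ∧-true (F₀ v) (F₁ v) Fv | b zero in eq
  ...   | F₀v , F₁v | false = false Vec.∷ v , F₀v , λ { zero → sym eq ; (suc i) → eqs i }
  ...   | F₀v , F₁v | true  = true Vec.∷ v , F₁v , λ { zero → sym eq ; (suc i) → eqs i }

sum-ind≤1 : ∀ {K} (α : Fin K → Bool) → (∀ i j → α i ≡ true → α j ≡ true → i ≡ j) → sum (ind ∘ α) ≤ 1
sum-ind≤1 {zero}  α unique = z≤n
sum-ind≤1 {suc K} α unique with α zero in eq
... | false = sum-ind≤1 (α ∘ suc) λ i j αi αj → Fin.suc-injective (unique (suc i) (suc j) αi αj)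
... | true  = s≤s (≤-trans (sum-mono {g = λ _ → 0} rest) (≤-reflexive (trans (sum-const K 0) (*-zeroʳ K))))
  where
  rest : ∀ i → ind (α (suc i)) ≤ 0
  rest i with α (suc i) in eq′
  ... | false = z≤n
  ... | true  = contradiction (unique zero (suc i) eq eq′) λ ()

-- The domain is restricted by `α` because the induction on m splits it by the first bit of `f i`.
card≤count : ∀ {K} m (α : Fin K → Bool) (f : Fin K → Vec Bool m) F →
  (∀ i j → α i ≡ true → α j ≡ true → f i ≡ f j → i ≡ j) → (∀ i → α i ≡ true → F (f i) ≡ true) →
  sum (ind ∘ α) ≤ count m F
card≤count {K} zero α f F inj F∘f with F Vec.[] in eq
... | true  = sum-ind≤1 α λ i j αi αj → inj i j αi αj (trivial (f i) (f j))
  where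
  trivial : (u v : Vec Bool 0) → u ≡ v
  trivial Vec.[] Vec.[] = refl
... | false = ≤-trans (sum-mono {g = λ _ → 0} none) (≤-reflexive (trans (sum-const K 0) (*-zeroʳ K)))
  where
  none : ∀ i → ind (α i) ≤ 0
  none i with α i in eq′
  ... | false = z≤n
  ... | true with f i | F∘f i eq′
  ...   | Vec.[] | Fi = contradiction (trans (sym Fi) eq) λ ()
card≤count {K} (suc m) α f F inj F∘f = begin
  sum (ind ∘ α)                             ≡⟨ sum-cong-≗ split ⟩
  sum (λ i → ind (α₀ i) + ind (α₁ i))       ≡⟨ ∑-distrib-+ (ind ∘ α₀) (ind ∘ α₁) ⟩
  sum (ind ∘ α₀) + sum (ind ∘ α₁)           ≤⟨ +-mono-≤ (card≤count m α₀ (Vec.tail ∘ f) _ inj₀ F∘₀) (card≤count m α₁ (Vec.tail ∘ f) _ inj₁′ F∘₁) ⟩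
  count (suc m) F                           ∎
  where
  open ≤-Reasoning
  α₀ α₁ : Fin K → Bool
  α₀ i = α i ∧ not (Vec.head (f i))
  α₁ i = α i ∧ Vec.head (f i)
  split : ∀ i → ind (α i) ≡ ind (α₀ i) + ind (α₁ i)
  split i with α i | Vec.head (f i)
  ... | false | _     = refl
  ... | true  | true  = refl
  ... | true  | false = refl
  not-true : ∀ {a} → not a ≡ true → a ≡ false
  not-true {false} _ = refl
  η : ∀ (v : Vec Bool (suc m)) → v ≡ Vec.head v Vec.∷ Vec.tail v
  η (x Vec.∷ v) = refl
  ext : ∀ {u v : Vec Bool (suc m)} {b} → Vec.head u ≡ b → Vec.head v ≡ b → Vec.tail u ≡ Vec.tail v → u ≡ v
  ext {x Vec.∷ u} {y Vec.∷ v} refl refl refl = refl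
  inj₀ : ∀ i j → α₀ i ≡ true → α₀ j ≡ true → Vec.tail (f i) ≡ Vec.tail (f j) → i ≡ j
  inj₀ i j p q t =
    let αi , hi = ∧-true (α i) _ p
        αj , hj = ∧-true (α j) _ q
    in inj i j αi αj (ext (not-true hi) (not-true hj) t)
  inj₁′ : ∀ i j → α₁ i ≡ true → α₁ j ≡ true → Vec.tail (f i) ≡ Vec.tail (f j) → i ≡ j
  inj₁′ i j p q t =
    let αi , hi = ∧-true (α i) _ p
        αj , hj = ∧-true (α j) _ q
    in inj i j αi αj (ext hi hj t)
  F∘₀ : ∀ i → α₀ i ≡ true → F (false Vec.∷ Vec.tail (f i)) ≡ true
  F∘₀ i p =
    let αi , hi = ∧-true (α i) _ p
    in trans (cong F (sym (trans (η (f i)) (cong (Vec._∷ Vec.tail (f i)) (not-true hi))))) (F∘f i αi)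
  F∘₁ : ∀ i → α₁ i ≡ true → F (true Vec.∷ Vec.tail (f i)) ≡ true
  F∘₁ i p =
    let αi , hi = ∧-true (α i) _ p
    in trans (cong F (sym (trans (η (f i)) (cong (Vec._∷ Vec.tail (f i)) hi)))) (F∘f i αi)

-- Shattering by families of pairwise far apart rows

-- The rows of `R` are the hyperedges, the columns the points. Injectivity of `y` is automatic,
-- since some row separates any two indices.
Shatters : ∀ {C V} → (Fin C → Fin V → Bool) → ℕ → Set
Shatters {C} {V} R k = ∃ λ (y : Fin k → Fin V) → ∀ (b : Fin k → Bool) → ∃ λ c → ∀ i → R c (y i) ≡ b i

module _ {I V : ℕ} (R : Fin I → Fin V → Bool) where

  missed : ∀ {m} → Vec (Fin V) m → Fin I → ℕ
  missed Vec.[]       i = 1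
  missed (u Vec.∷ us) i = ind (not (R i u)) * missed us i

  missed-all : ∀ {m} (us : Vec (Fin V) m) i → (∀ k → R i (lookup us k) ≡ false) → missed us i ≡ 1
  missed-all Vec.[]       i out = refl
  missed-all (u Vec.∷ us) i out rewrite out zero = trans (+-identityʳ _) (missed-all us i (out ∘ suc))

-- By averaging, some column hits at least a 1 / (q + 1) share of the weight. Setting the weights of
-- the rows hit to zero, each new point leaves at most a q / (q + 1) share.
greedy-cover : ∀ {I V} (R : Fin I → Fin (suc V) → Bool) q →
  (∀ i → suc V ≤ suc q * sum (ind ∘ R i)) → ∀ m (α : Fin I → ℕ) →
  ∃ λ (us : Vec (Fin (suc V)) m) → suc q ^ m * sum (λ i → α i * missed R us i) ≤ q ^ m * sum α
greedy-cover R q dense zero α = Vec.[] , *-monoʳ-≤ 1 (sum-mono λ i → ≤-reflexive (*-identityʳ (α i)))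
greedy-cover {I} {V} R q dense (suc m) α = u Vec.∷ us , (begin
  suc q * suc q ^ m * sum (λ i → α i * (ind (not (R i u)) * missed R us i))
    ≡⟨ cong (suc q * suc q ^ m *_) (sum-cong-≗ λ i → sym (*-assoc (α i) (ind (not (R i u))) (missed R us i))) ⟩
  suc q * suc q ^ m * sum (λ i → α′ i * missed R us i)
    ≡⟨ *-assoc (suc q) (suc q ^ m) _ ⟩
  suc q * (suc q ^ m * sum (λ i → α′ i * missed R us i))
    ≤⟨ *-monoʳ-≤ (suc q) bound ⟩
  suc q * (q ^ m * sum α′)
    ≡⟨ x*yz≡y*xz (suc q) (q ^ m) (sum α′) ⟩
  q ^ m * (suc q * sum α′)
    ≤⟨ *-monoʳ-≤ (q ^ m) decrease ⟩
  q ^ m * (q * sum α)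
    ≡⟨ trans (x*yz≡y*xz (q ^ m) q (sum α)) (sym (*-assoc q (q ^ m) (sum α))) ⟩
  q * q ^ m * sum α ∎)
  where
  open ≤-Reasoning
  hits : Fin (suc V) → ℕ
  hits v = sum λ i → α i * ind (R i v)
  average : sum {suc V} (λ _ → sum α) ≤ sum (λ v → suc q * hits v)
  average = begin
    sum {suc V} (λ _ → sum α)                            ≡⟨ trans (sum-const (suc V) (sum α)) (*-distribˡ-sum (suc V) α) ⟩
    sum (λ i → suc V * α i)                              ≡⟨ sum-cong-≗ (λ i → *-comm (suc V) (α i)) ⟩
    sum (λ i → α i * suc V)                              ≤⟨ sum-mono (λ i → *-monoʳ-≤ (α i) (dense i)) ⟩
    sum (λ i → α i * (suc q * sum (ind ∘ R i)))          ≡⟨ sum-cong-≗ (λ i → x*yz≡y*xz (α i) (suc q) _) ⟩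
    sum (λ i → suc q * (α i * sum (ind ∘ R i)))          ≡⟨ *-distribˡ-sum (suc q) (λ i → α i * sum (ind ∘ R i)) ⟨
    suc q * sum (λ i → α i * sum (ind ∘ R i))            ≡⟨ cong (suc q *_) (sum-cong-≗ λ i → *-distribˡ-sum (α i) (ind ∘ R i)) ⟩
    suc q * sum (λ i → sum λ v → α i * ind (R i v))      ≡⟨ cong (suc q *_) (∑-comm λ i v → α i * ind (R i v)) ⟩
    suc q * sum hits                                     ≡⟨ *-distribˡ-sum (suc q) hits ⟩
    sum (λ v → suc q * hits v)                           ∎
  best = sum≤⇒∃≤ (λ _ → sum α) (λ v → suc q * hits v) average
  u = proj₁ best
  α′ : Fin I → ℕ
  α′ i = α i * ind (not (R i u))
  rest = greedy-cover R q dense m α′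
  us = proj₁ rest
  bound = proj₂ rest
  split : sum α ≡ hits u + sum α′
  split = trans
    (sum-cong-≗ λ i → trans (sym (*-identityʳ (α i))) (trans (cong (α i *_) (sym (ind-not (R i u)))) (*-distribˡ-+ (α i) _ _)))
    (∑-distrib-+ (λ i → α i * ind (R i u)) α′)
  decrease : suc q * sum α′ ≤ q * sum α
  decrease = +-cancelʳ-≤ (sum α) _ _ (begin
    suc q * sum α′ + sum α               ≤⟨ +-monoʳ-≤ (suc q * sum α′) (proj₂ best) ⟩
    suc q * sum α′ + suc q * hits u      ≡⟨ *-distribˡ-+ (suc q) (sum α′) (hits u) ⟨
    suc q * (sum α′ + hits u)            ≡⟨ cong (suc q *_) (trans (+-comm (sum α′) (hits u)) (sym split)) ⟩
    suc q * sum α                        ≡⟨ +-comm (sum α) (q * sum α) ⟩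
    q * sum α + sum α                    ∎)

-- For K = 2 ^ t rows there are 2 ^ (2t) pairs. By `doubling`, m rounds of `greedy-cover` divide
-- this weight by at least 2 ^ (2t + 1), so less than 1 remains.
decayed : ∀ q t S → let m = suc (suc q) * suc (t + t) in
  suc (suc q) ^ m * S ≤ suc q ^ m * (2 ^ t * 2 ^ t) → S ≡ 0
decayed q t zero    _  = refl
decayed q t (suc s) le = contradiction (^-monoʳ-< 2 ≤-refl (n<1+n (t + t))) (≤⇒≯ (*-cancelʳ-≤ (2 ^ suc (t + t)) (2 ^ (t + t)) (suc q ^ m) (begin
  2 ^ suc (t + t) * suc q ^ m       ≤⟨ doubling (suc q) (suc (t + t)) ⟩
  suc (suc q) ^ m                   ≤⟨ m≤m*n (suc (suc q) ^ m) (suc s) ⟩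
  suc (suc q) ^ m * suc s           ≤⟨ le ⟩
  suc q ^ m * (2 ^ t * 2 ^ t)       ≡⟨ cong (suc q ^ m *_) (^-distribˡ-+-* 2 t t) ⟨
  suc q ^ m * 2 ^ (t + t)           ≡⟨ *-comm (suc q ^ m) _ ⟩
  2 ^ (t + t) * suc q ^ m           ∎)))
  where
  open ≤-Reasoning
  m = suc (suc q) * suc (t + t)
  instance
    _ : NonZero (suc q ^ m)
    _ = m^n≢0 (suc q) m

-- Few greedily chosen points separate all rows, so by Sauer–Shelah a large family of
-- pairwise far apart rows shatters many points.
separated⇒shatters : ∀ {V} d q m K → suc m ^ d < K → (∀ S → suc q ^ m * S ≤ q ^ m * (K * K) → S ≡ 0) →
  (R : Fin K → Fin (suc V) → Bool) →
  (∀ i j → i ≢ j → suc V ≤ suc q * sum (λ v → ind (R i v xor R j v))) →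
  Shatters R (suc d)
separated⇒shatters {V} d q m K large decay R far = lookup us ∘ proj₁ shattered , realize
  where
  open ≤-Reasoning
  -- On the diagonal all columns count as differing, so that each of the K * K pairs is dense.
  differ : Fin K → Fin K → Fin (suc V) → Bool
  differ i j v with i Fin.≟ j
  ... | yes _ = true
  ... | no  _ = R i v xor R j v
  differ-far : ∀ i j → suc V ≤ suc q * sum (λ v → ind (differ i j v))
  differ-far i j with i Fin.≟ j
  ... | yes _  = ≤-trans (≤-reflexive (sym (trans (sum-const (suc V) 1) (*-identityʳ (suc V))))) (m≤m+n _ _)
  ... | no i≢j = far i j i≢j
  pairs : Fin (K * K) → Fin (suc V) → Bool
  pairs ij = differ (proj₁ (remQuot {K} K ij)) (proj₂ (remQuot {K} K ij))
  cover = greedy-cover pairs q (λ ij → differ-far (proj₁ (remQuot {K} K ij)) (proj₂ (remQuot {K} K ij))) m (λ _ → 1)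
  us = proj₁ cover
  S = sum (λ ij → 1 * missed pairs us ij)
  S≡0 : S ≡ 0
  S≡0 = decay S (≤-trans (proj₂ cover) (*-monoʳ-≤ (q ^ m) (≤-reflexive (trans (sum-const (K * K) 1) (*-identityʳ (K * K))))))
  trace : Fin K → Vec Bool m
  trace i = Vec.map (R i) us
  trace-injective : ∀ i j → trace i ≡ trace j → i ≡ j
  trace-injective i j eq with i Fin.≟ j
  ... | yes i≡j = i≡j
  ... | no i≢j  = contradiction (trans (sym S≡0′) missed≡1) λ ()
    where
    same : ∀ k → R i (lookup us k) ≡ R j (lookup us k)
    same k = trans (sym (Vec.lookup-map k (R i) us)) (trans (cong (λ v → lookup v k) eq) (Vec.lookup-map k (R j) us))
    xor-same : ∀ a → a xor a ≡ false
    xor-same true  = refl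
    xor-same false = refl
    agree : ∀ v → R i v ≡ R j v → differ i j v ≡ false
    agree v e with i Fin.≟ j
    ... | yes i≡j = contradiction i≡j i≢j
    ... | no _    = trans (cong (_xor R j v) e) (xor-same (R j v))
    rq : remQuot {K} K (combine i j) ≡ (i , j)
    rq = Fin.remQuot-combine i j
    missed≡1 : missed pairs us (combine i j) ≡ 1
    missed≡1 = missed-all pairs us (combine i j) λ k →
      trans (cong (λ p → differ (proj₁ p) (proj₂ p) (lookup us k)) rq) (agree (lookup us k) (same k))
    S≡0′ : missed pairs us (combine i j) ≡ 0
    S≡0′ = n≤0⇒n≡0 (≤-trans (≤-reflexive (sym (*-identityˡ _))) (≤-trans (term≤sum (λ ij → 1 * missed pairs us ij) (combine i j)) (≤-reflexive S≡0)))
  isTrace? : ∀ v → Dec (∃ λ i → trace i ≡ v)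
  isTrace? v = Fin.any? λ i → Vec.≡-dec Bool._≟_ (trace i) v
  isTrace : Vec Bool m → Bool
  isTrace v = does (isTrace? v)
  manyTraces : K ≤ count m isTrace
  manyTraces = begin
    K                               ≡⟨ trans (sum-const K 1) (*-identityʳ K) ⟨
    sum {K} (λ _ → ind true)        ≤⟨ card≤count m (λ _ → true) trace isTrace (λ i j _ _ → trace-injective i j) (λ i _ → dec-true (isTrace? (trace i)) (i , refl)) ⟩
    count m isTrace                 ∎
  shattered = sauer m (suc d) isTrace (<-≤-trans (≤-<-trans (sauerBound≤ m d) large) manyTraces)
  realize : ∀ b → ∃ λ i → ∀ k → R i (lookup us (proj₁ shattered k)) ≡ b k
  realize b with proj₂ shattered b
  ... | v , v-trace , eqs with isTrace? v
  ...   | yes (i , refl) = i , λ k → trans (sym (Vec.lookup-map (proj₁ shattered k) (R i) us)) (eqs k)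
  ...   | no _ = contradiction v-trace λ ()

-- ε-nets for dense rows

-- Subsets of `Fin k` are numbered by `Fin (2 ^ k)`, so that sums and searches can run over them.
mem : ∀ {k} → Fin (2 ^ k) → Fin k → Bool
mem J i = does (finToFun J i Fin.≟ suc zero)

bit : Bool → Fin 2
bit b = if b then suc zero else zero

subset : ∀ {k} → (Fin k → Bool) → Fin (2 ^ k)
subset b = funToFin (bit ∘ b)

mem-subset : ∀ {k} (b : Fin k → Bool) i → mem (subset b) i ≡ b i
mem-subset b i = trans (cong (λ z → does (z Fin.≟ suc zero)) (Fin.finToFun-funToFin (bit ∘ b) i)) (bit-one (b i))
  where
  bit-one : ∀ x → does (bit x Fin.≟ suc zero) ≡ x
  bit-one true  = refl
  bit-one false = refl

event-false : ∀ m r → (if m then 0 else ind (not r)) ≡ 0 → m ≡ false → r ≡ true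
event-false false true _ _ = refl

cut-out : ∀ {m r} b → m ≡ not b → (m ≡ false → r ≡ true) → (m ≡ true → r ≡ false) → r ≡ b
cut-out true  m≡ out _  = out m≡
cut-out false m≡ _   in′ = in′ m≡

module _ {C V : ℕ} (R : Fin C → Fin (suc V) → Bool) where

  -- At most a 1 / `Q` share of row `c` lies outside row `c′`; the relation is not symmetric.
  Close : ℕ → Fin C → Fin C → Set
  Close Q c c′ = Q * sum (λ v → ind (R c v) * ind (not (R c′ v))) ≤ sum (ind ∘ R c)

  Close? : ∀ Q c c′ → Dec (Close Q c c′)
  Close? Q c c′ = _ ≤? _

  -- If every k-tuple P were missed by some row e(P) close to c, then for random
  -- points of c the row e of the subtuple J would typically contain all points outside
  -- J, and so cut out precisely the complement of J.
  hit-close : ∀ k Q → 2 ^ k * k < Q → ∀ c → 0 < sum (ind ∘ R c) → ¬ Shatters R k →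
    ∃ λ (P : Fin k → Fin (suc V)) → ∀ c′ → Close Q c c′ → ∃ λ i → R c′ (P i) ≡ true
  hit-close k Q Q-large c W>0 ¬shattered
    with Fin.any? {n = suc V ^ k} (λ z → Fin.all? λ c′ → Close? Q c c′ →-dec Fin.any? λ i → R c′ (finToFun z i) Bool.≟ true)
  ... | yes (z , hit) = finToFun z , hit
  ... | no ¬hit = contradiction (lookup us , realize) ¬shattered
    where
    w = ind ∘ R c
    miss : ∀ (P : Fin k → Fin (suc V)) → ∃ λ c′ → Close Q c c′ × (∀ i → R c′ (P i) ≡ false)
    miss P with Fin.any? (λ c′ → Close? Q c c′ ×-dec Fin.all? λ i → R c′ (P i) Bool.≟ false)
    ... | yes found = found
    ... | no ¬found = contradiction (funToFin P , λ c′ close → hitAt c′ close) ¬hit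
      where
      hitAt : ∀ c′ → Close Q c c′ → ∃ λ i → R c′ (finToFun (funToFin P) i) ≡ true
      hitAt c′ close with Fin.any? (λ i → R c′ (P i) Bool.≟ true)
      ... | yes (i , hit) = i , trans (cong (R c′) (Fin.finToFun-funToFin P i)) hit
      ... | no ¬any = contradiction (c′ , close , λ i → Bool.¬-not λ hit → ¬any (i , hit)) ¬found
    pick : Vec (Fin (suc V)) k → Fin C
    pick us = proj₁ (miss (lookup us))
    -- Coordinates outside J are replaced by a fixed point, so the row picked for J is independent
    -- of them.
    mask : Fin (2 ^ k) → Vec (Fin (suc V)) k → Vec (Fin (suc V)) k
    mask J us = Vec.tabulate λ i → if mem J i then lookup us i else zero
    event : Fin (2 ^ k) → Fin k → Vec (Fin (suc V)) k → ℕ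
    event J j us = if mem J j then 0 else ind (not (R (pick (mask J us)) (lookup us j)))
    mask-update : ∀ J j us u → mem J j ≡ false → mask J (us [ j ]≔ u) ≡ mask J us
    mask-update J j us u j∉J = Vec.tabulate-cong same
      where
      same : ∀ i → (if mem J i then lookup (us [ j ]≔ u) i else zero) ≡ (if mem J i then lookup us i else zero)
      same i with mem J i in eq
      ... | false = refl
      ... | true  = Vec.lookup∘update′ (λ { refl → contradiction (trans (sym eq) j∉J) λ () }) us u
    event-rare : ∀ J j us → Q * sum (λ u → w u * event J j (us [ j ]≔ u)) ≤ sum w
    event-rare J j us with mem J j in eq
    ... | true  = ≤-trans (≤-reflexive (trans (cong (Q *_) (trans (sum-cong-≗ λ u → *-zeroʳ (w u)) (trans (sum-const (suc V) 0) (*-zeroʳ (suc V))))) (*-zeroʳ Q))) z≤n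
    ... | false = ≤-trans (≤-reflexive (cong (Q *_) (sum-cong-≗ λ u →
      cong₂ (λ us′ v → w u * ind (not (R (pick us′) v))) (mask-update J j us u eq) (Vec.lookup∘update j us u))))
      (proj₁ (proj₂ (miss (lookup (mask J us)))))
    -- Union bound over the 2 ^ k sets J and the k indices j.
    avoided = rare-avoid w Q k W>0 (≤-<-trans (≤-reflexive (cong (2 ^ k *_) (*-identityʳ k))) Q-large)
      (rare-sum w Q k (λ J us → sum λ j → event J j us) λ J →
        rare-sum w Q k (event J) λ j → rare-coordinate w Q k j (event J j) (event-rare J j))
    us = proj₁ avoided
    event≡0 : ∀ J j → event J j us ≡ 0
    event≡0 J j = n≤0⇒n≡0 (≤-trans (term≤sum (λ j → event J j us) j)
      (≤-trans (term≤sum (λ J → sum λ j → event J j us) J) (≤-reflexive (proj₂ avoided))))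
    realize : ∀ b → ∃ λ c′ → ∀ i → R c′ (lookup us i) ≡ b i
    realize b = c′ , correct
      where
      J = subset (not ∘ b)
      c′ = pick (mask J us)
      outside : ∀ i → mem J i ≡ false → R c′ (lookup us i) ≡ true
      outside i = event-false (mem J i) _ (event≡0 J i)
      inside : ∀ i → mem J i ≡ true → R c′ (lookup us i) ≡ false
      inside i i∈J = trans
        (cong (R c′) (sym (trans (Vec.lookup∘tabulate _ i) (cong (λ m → if m then lookup us i else zero) i∈J))))
        (proj₂ (proj₂ (miss (lookup (mask J us)))) i)
      correct : ∀ i → R c′ (lookup us i) ≡ b i
      correct i = cut-out (b i) (mem-subset (not ∘ b) i) (outside i) (inside i)

-- New elements are put in front, so a larger index means an earlier choice. The separation is
-- one-sided because `∼` may be asymmetric.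
greedy-packing : ∀ {C} (_∼_ : Fin C → Fin C → Set) → (∀ c c′ → Dec (c ∼ c′)) → ∀ K →
  (∃ λ j → j ≤ K × ∃ λ (f : Fin j → Fin C) → ∀ c → ∃ λ i → f i ∼ c) ⊎
  (∃ λ (f : Fin K → Fin C) → ∀ i j → toℕ i < toℕ j → ¬ (f j ∼ f i))
greedy-packing _∼_ _∼?_ zero = inj₂ ((λ ()) , λ ())
greedy-packing _∼_ _∼?_ (suc K) with greedy-packing _∼_ _∼?_ K
... | inj₁ (j , j≤K , cover) = inj₁ (j , m≤n⇒m≤1+n j≤K , cover)
... | inj₂ (f , sep) with Fin.any? (λ c → Fin.all? λ i → ¬? (f i ∼? c))
...   | no ¬new = inj₁ (K , n≤1+n K , f , covered)
  where
  covered : ∀ c → ∃ λ i → f i ∼ c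
  covered c with Fin.any? (λ i → f i ∼? c)
  ... | yes found = found
  ... | no ¬any   = contradiction (c , λ i fi∼c → ¬any (i , fi∼c)) ¬new
...   | yes (c , new) = inj₂ (g , sep′)
  where
  g : Fin (suc K) → _
  g zero    = c
  g (suc i) = f i
  sep′ : ∀ i j → toℕ i < toℕ j → ¬ (g j ∼ g i)
  sep′ zero    (suc j) lt       = new j
  sep′ (suc i) (suc j) (s≤s lt) = sep i j lt

module NetSize (d E : ℕ) where
  -- `Q` exceeds the number of events in `hit-close`. Rows that are not close differ in at least a 1
  -- / q share of the columns, and `t` is chosen such that 2 ^ t such rows exceed the Sauer-Shelah
  -- bound on m points, where m + 1 ≤ `c * suc t`. Each of at most 2 ^ t greedy rows contributes `k`
  -- points to the net.
  k Q q c t size : ℕ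
  k = suc d
  Q = suc (2 ^ k * k)
  q = E * Q
  c = suc (2 * suc (suc q))
  t = proj₁ (polynomial<exp c d)
  size = 2 ^ t * k

  net : ∀ {C V} (R : Fin C → Fin (suc V) → Bool) → ¬ Shatters R (suc d) →
    (∀ c → suc V ≤ E * sum (ind ∘ R c)) →
    ∃ λ s → s ≤ size × ∃ λ (g : Fin s → Fin (suc V)) → ∀ c → ∃ λ i → R c (g i) ≡ true
  net {C} {V} R ¬shattered dense with greedy-packing (Close R Q) (Close? R Q) (2 ^ t)
  ... | inj₁ (j , j≤ , f , cover) = j * k , *-monoˡ-≤ k j≤ , g , hit
    where
    pos : ∀ c → 0 < sum (ind ∘ R c)
    pos c with sum (ind ∘ R c) in eq
    ... | suc _ = s≤s z≤n
    ... | zero  = contradiction (≤-trans (dense c) (≤-reflexive (trans (cong (E *_) eq) (*-zeroʳ E)))) λ ()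
    local : ∀ i → _
    local i = hit-close R k Q ≤-refl (f i) (pos (f i)) ¬shattered
    g : Fin (j * k) → Fin (suc V)
    g z = proj₁ (local (proj₁ (remQuot {j} k z))) (proj₂ (remQuot {j} k z))
    hit : ∀ c → ∃ λ z → R c (g z) ≡ true
    hit c =
      let i , close = cover c
          l , Rl = proj₂ (local i) c close
      in combine i l , trans (cong (λ p → R c (proj₁ (local (proj₁ p)) (proj₂ p))) (Fin.remQuot-combine i l)) Rl
  ... | inj₂ (f , sep) = contradiction
      (let y , realize = separated⇒shatters d (suc q) m (2 ^ t) large (decayed q t) (R ∘ f) far
       in y , λ b → let i , eq = realize b in f i , eq)
      ¬shattered
    where
    open ≤-Reasoning
    m = suc (suc q) * suc (t + t)
    lemma : ∀ p t → 0 + suc (2 * p) * suc t ≡ 0 + suc (p * suc (t + t)) + (t + p)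
    lemma p t = solve (p ∷ t ∷ [])
    large : suc m ^ d < 2 ^ t
    large = ≤-<-trans (^-monoˡ-≤ d (certify (t + suc (suc q)) (≤-refl {0}) (lemma (suc (suc q)) t))) (proj₂ (polynomial<exp c d))
    setminus≤xor : ∀ a b → ind a * ind (not b) ≤ ind (a xor b)
    setminus≤xor true  true  = z≤n
    setminus≤xor true  false = ≤-refl
    setminus≤xor false b     = z≤n
    xor-comm : ∀ a b → a xor b ≡ b xor a
    xor-comm true  true  = refl
    xor-comm true  false = refl
    xor-comm false true  = refl
    xor-comm false false = refl
    far< : ∀ i j → toℕ i < toℕ j → suc V ≤ suc (suc q) * sum (λ v → ind (R (f j) v xor R (f i) v))
    far< i j lt = begin
      suc V                                                              ≤⟨ dense (f j) ⟩
      E * sum (ind ∘ R (f j))                                            ≤⟨ *-monoʳ-≤ E (<⇒≤ (≰⇒> (sep i j lt))) ⟩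
      E * (Q * sum (λ v → ind (R (f j) v) * ind (not (R (f i) v))))      ≡⟨ *-assoc E Q _ ⟨
      q * sum (λ v → ind (R (f j) v) * ind (not (R (f i) v)))            ≤⟨ *-mono-≤ (m≤n+m q 2) (sum-mono λ v → setminus≤xor (R (f j) v) (R (f i) v)) ⟩
      suc (suc q) * sum (λ v → ind (R (f j) v xor R (f i) v))            ∎
    far : ∀ i j → i ≢ j → suc V ≤ suc (suc q) * sum (λ v → ind (R (f i) v xor R (f j) v))
    far i j i≢j with <-cmp (toℕ i) (toℕ j)
    ... | tri> _ _ j<i = far< j i j<i
    ... | tri≈ _ eq _  = contradiction (Fin.toℕ-injective eq) i≢j
    ... | tri< i<j _ _ = ≤-trans (far< i j i<j) (≤-reflexive (cong (suc (suc q) *_) (sum-cong-≗ λ v → cong ind (xor-comm (R (f j) v) (R (f i) v)))))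

-- Multiplicative weights

misses : ∀ {C V T} → (Fin C → Fin V → Bool) → (Fin T → Fin V) → Fin C → ℕ
misses R M c = sum λ t → ind (not (R c (M t)))

-- When there are rows, LP duality would turn this into a distribution on the points that gives each
-- row mass at least 1 / Q; `many-hits` achieves this up to a factor of 4.
Heavy : ∀ {C V} → (Fin C → Fin V → Bool) → ℕ → Set
Heavy {C} R Q = ∀ (w : Fin C → ℕ) → 0 < sum w → ∃ λ v → sum w ≤ Q * sum λ c → w c * ind (R c v)

-- Multiplicative weights: give a row the weight 2 ^ misses, and always append a point
-- that is heavy for the current weights.  The total weight then grows so slowly
-- that no row can be missed too often.
module MultiplicativeWeights {C V : ℕ} (R : Fin (suc C) → Fin V → Bool) (q : ℕ) (heavy : Heavy R (suc q)) where

  Q p : ℕ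
  Q = suc q
  p = suc (q + q)

  weight : ∀ {T} → (Fin T → Fin V) → Fin (suc C) → ℕ
  weight M c = 2 ^ misses R M c

  -- Only the missed rows double, and they carry at most a 1 - 1 / `Q` share. Hence each point
  -- multiplies the total by at most 2 - 1 / `Q` = `p` / `Q`.
  potential : ∀ T → ∃ λ (M : Fin T → Fin V) → Q ^ T * sum (weight M) ≤ p ^ T * suc C
  potential zero = (λ ()) , *-monoʳ-≤ 1 (≤-reflexive (trans (sum-const (suc C) 1) (*-identityʳ (suc C))))
  potential (suc T) = M′ , (begin
    Q * Q ^ T * sum (weight M′)       ≡⟨ trans (*-assoc Q (Q ^ T) _) (x*yz≡y*xz Q (Q ^ T) _) ⟩
    Q ^ T * (Q * sum (weight M′))     ≤⟨ *-monoʳ-≤ (Q ^ T) decrease ⟩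
    Q ^ T * (p * W)                   ≡⟨ x*yz≡y*xz (Q ^ T) p W ⟩
    p * (Q ^ T * W)                   ≤⟨ *-monoʳ-≤ p (proj₂ previous) ⟩
    p * (p ^ T * suc C)               ≡⟨ *-assoc p (p ^ T) (suc C) ⟨
    p * p ^ T * suc C                 ∎)
    where
    open ≤-Reasoning
    previous = potential T
    M = proj₁ previous
    w = weight M
    W = sum w
    W>0 : 0 < W
    W>0 = <-≤-trans (m^n>0 2 (misses R M zero)) (term≤sum w zero)
    v = proj₁ (heavy w W>0)
    M′ : Fin (suc T) → Fin V
    M′ zero    = v
    M′ (suc t) = M t
    H N : ℕ
    H = sum λ c → w c * ind (R c v)
    N = sum λ c → w c * ind (not (R c v))
    W≡H+N : W ≡ H + N
    W≡H+N = trans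
      (sum-cong-≗ λ c → trans (sym (*-identityʳ (w c))) (trans (cong (w c *_) (sym (ind-not (R c v)))) (*-distribˡ-+ (w c) (ind (R c v)) (ind (not (R c v))))))
      (∑-distrib-+ (λ c → w c * ind (R c v)) (λ c → w c * ind (not (R c v))))
    double : ∀ x b → 2 ^ (ind b + x) ≡ 2 ^ x + 2 ^ x * ind b
    double x true  = trans (cong (2 ^ x +_) (+-identityʳ (2 ^ x))) (cong (2 ^ x +_) (sym (*-identityʳ (2 ^ x))))
    double x false = sym (trans (cong (2 ^ x +_) (*-zeroʳ (2 ^ x))) (+-identityʳ (2 ^ x)))
    W′≡W+N : sum (weight M′) ≡ W + N
    W′≡W+N = trans (sum-cong-≗ λ c → double (misses R M c) (not (R c v))) (∑-distrib-+ w λ c → w c * ind (not (R c v)))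
    arithmetic : ∀ q w h n → suc q * (w + n) + suc q * h ≡ suc q * (w + (h + n))
    arithmetic q w h n = solve (q ∷ w ∷ h ∷ n ∷ [])
    arithmetic′ : ∀ q w → suc q * (w + w) ≡ suc (q + q) * w + w
    arithmetic′ q w = solve (q ∷ w ∷ [])
    decrease : Q * sum (weight M′) ≤ p * W
    decrease = +-cancelʳ-≤ W (Q * sum (weight M′)) (p * W) (begin
      Q * sum (weight M′) + W          ≤⟨ +-monoʳ-≤ (Q * sum (weight M′)) (proj₂ (heavy w W>0)) ⟩
      Q * sum (weight M′) + Q * H      ≡⟨ cong (λ x → Q * x + Q * H) W′≡W+N ⟩
      Q * (W + N) + Q * H              ≡⟨ arithmetic q W H N ⟩
      Q * (W + (H + N))                ≡⟨ cong (λ x → Q * (W + x)) W≡H+N ⟨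
      Q * (W + W)                      ≡⟨ arithmetic′ q W ⟩
      p * W + W                        ∎)

  -- By `doubling`, `T` rounds make ((p + 1) / p) ^ T at least 2 ^ s. One half of s = 2 (C + 1) pays
  -- for the initial potential, the other half is left over as hits.
  s T : ℕ
  s = suc C + suc C
  T = suc p * s

  M : Fin T → Fin V
  M = proj₁ (potential T)

  -- The weight 2 ^ m of a row missed m times is at most the total weight. Since p + 1 = 2 `Q`, the
  -- bound on the latter falls short of 2 ^ T * suc C by a factor of at least 2 ^ s, so m is well
  -- below T.
  many-hits : ∀ c → T ≤ (suc p + suc p) * sum (λ t → ind (R c (M t)))
  many-hits c = begin
    suc p * s                              ≡⟨ *-distribˡ-+ (suc p) (suc C) (suc C) ⟩
    suc p * suc C + suc p * suc C          ≡⟨ *-distribʳ-+ (suc C) (suc p) (suc p) ⟨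
    (suc p + suc p) * suc C                ≤⟨ *-monoʳ-≤ (suc p + suc p) (<⇒≤ C<hits) ⟩
    (suc p + suc p) * hits                 ∎
    where
    open ≤-Reasoning
    hits = sum λ t → ind (R c (M t))
    m = misses R M c
    T≡ : T ≡ hits + m
    T≡ = trans (sym (trans (sum-const T 1) (*-identityʳ T)))
      (trans (sum-cong-≗ λ t → sym (ind-not (R c (M t)))) (∑-distrib-+ (λ t → ind (R c (M t))) (λ t → ind (not (R c (M t))))))
    2Q≡ : suc p ≡ 2 * Q
    2Q≡ = cong suc (trans (sym (+-suc q q)) (cong (q +_) (sym (+-identityʳ (suc q)))))
    instance
      _ : NonZero (p ^ T)
      _ = m^n≢0 p T
    small : p ^ T * 2 ^ (s + m) ≤ p ^ T * (2 ^ T * suc C)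
    small = begin
      p ^ T * 2 ^ (s + m)           ≡⟨ cong (p ^ T *_) (^-distribˡ-+-* 2 s m) ⟩
      p ^ T * (2 ^ s * 2 ^ m)       ≡⟨ *-assoc (p ^ T) (2 ^ s) (2 ^ m) ⟨
      p ^ T * 2 ^ s * 2 ^ m         ≡⟨ cong (_* 2 ^ m) (*-comm (p ^ T) (2 ^ s)) ⟩
      2 ^ s * p ^ T * 2 ^ m         ≤⟨ *-monoˡ-≤ (2 ^ m) (doubling p s) ⟩
      suc p ^ T * 2 ^ m             ≡⟨ cong (λ x → x ^ T * 2 ^ m) 2Q≡ ⟩
      (2 * Q) ^ T * 2 ^ m           ≡⟨ cong (_* 2 ^ m) (^-distribʳ-* 2 Q T) ⟩
      2 ^ T * Q ^ T * 2 ^ m         ≡⟨ *-assoc (2 ^ T) (Q ^ T) (2 ^ m) ⟩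
      2 ^ T * (Q ^ T * 2 ^ m)       ≤⟨ *-monoʳ-≤ (2 ^ T) (*-monoʳ-≤ (Q ^ T) (term≤sum (weight M) c)) ⟩
      2 ^ T * (Q ^ T * sum (weight M))  ≤⟨ *-monoʳ-≤ (2 ^ T) (proj₂ (potential T)) ⟩
      2 ^ T * (p ^ T * suc C)       ≡⟨ x*yz≡y*xz (2 ^ T) (p ^ T) (suc C) ⟩
      p ^ T * (2 ^ T * suc C)       ∎
    exponents : s + m < T + suc C
    exponents = ≰⇒> λ ge → contradiction (^-monoʳ-≤ 2 ge) (<⇒≱ (begin-strict
      2 ^ (s + m)                ≤⟨ *-cancelˡ-≤ (p ^ T) small ⟩
      2 ^ T * suc C              <⟨ *-monoʳ-< (2 ^ T) {{m^n≢0 2 T}} (n<2^n (suc C)) ⟩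
      2 ^ T * 2 ^ suc C          ≡⟨ ^-distribˡ-+-* 2 T (suc C) ⟨
      2 ^ (T + suc C)            ∎))
    C<hits : suc C < hits
    C<hits = +-cancelʳ-< (m + suc C) (suc C) hits (subst₂ _<_
      (trans (+-assoc (suc C) (suc C) m) (cong (suc C +_) (+-comm (suc C) m)))
      (trans (cong (_+ suc C) T≡) (+-assoc hits m (suc C)))
      exponents)

hittingSize : ℕ → ℕ → ℕ
hittingSize d q = let p = suc (q + q) in NetSize.size d (suc p + suc p)

-- The net is taken among the indices of the sequence `M`, where every row is dense; indices
-- shattered there give points shattered by `R`.
hittingSet : ∀ {C V} (R : Fin C → Fin V → Bool) d q → ¬ Shatters R (suc d) → Heavy R (suc q) →
  ∃ λ s → s ≤ hittingSize d q × ∃ λ (g : Fin s → Fin V) → ∀ c → ∃ λ i → R c (g i) ≡ true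
hittingSet {zero}  R d q ¬shattered heavy = 0 , z≤n , (λ ()) , λ ()
hittingSet {suc C} R d q ¬shattered heavy =
  let s , s≤ , g , hit = NetSize.net d (suc p + suc p) (λ c t → R c (M t)) (λ { (y , realize) → ¬shattered (M ∘ y , realize) }) many-hits
  in s , s≤ , M ∘ g , hit
  where open MultiplicativeWeights R q heavy

-- Walks and truncated distances

-- The search is capped at `B`, which is returned if no smaller number satisfies `P`.
least : ∀ {P : ℕ → Set} → (∀ k → Dec (P k)) → ∀ B → ∃ λ k → k ≤ B × (k < B → P k) × (∀ j → P j → k ≤ j)
least P? zero = 0 , z≤n , (λ ()) , λ _ _ → z≤n
least P? (suc B) with P? 0
... | yes P0 = 0 , z≤n , (λ _ → P0) , λ _ _ → z≤n
... | no ¬P0 with least (P? ∘ suc) B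
...   | k , k≤B , Pk , below = suc k , s≤s k≤B , (λ lt → Pk (s≤s⁻¹ lt)) ,
  λ { zero P0 → contradiction P0 ¬P0 ; (suc j) Pj → s≤s (below j Pj) }

halve : ∀ D → ∃ λ h → ∃ λ e → e ≤ 1 × D ≡ h + (e + h)
halve zero          = 0 , 0 , z≤n , refl
halve (suc zero)    = 0 , 1 , ≤-refl , refl
halve (suc (suc D)) with halve D
... | h , e , e≤1 , refl = suc h , e , e≤1 , cong suc (trans (sym (+-suc h (e + h))) (cong (h +_) (sym (+-suc e h))))

half≤ : ∀ h s → h + h ≤ suc (s + s) → h ≤ s
half≤ zero    s       _  = z≤n
half≤ (suc h) zero    le = contradiction (≤-trans (≤-reflexive (sym (cong suc (+-suc h h)))) le) λ { (s≤s ()) }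
half≤ (suc h) (suc s) le = s≤s (half≤ h s (s≤s⁻¹ (s≤s⁻¹ (subst₂ _≤_ (cong suc (+-suc h h)) (cong (λ z → suc (suc z)) (+-suc s s)) le))))

module _ {G : Graph} where

  private V = Fin (n G)

  walk-start : ∀ {S x y k} → Walk G S x y k → x ∈ S
  walk-start (here x∈S)     = x∈S
  walk-start (step x∈S _ _) = x∈S

  walk-++ : ∀ {S x y z j k} → Walk G S x y j → Walk G S y z k → Walk G S x z (j + k)
  walk-++ (here _)         q = q
  walk-++ (step x∈S x~y p) q = step x∈S x~y (walk-++ p q)

  walk-snoc : ∀ {S x y z k} → Walk G S x y k → adj G y z ≡ true → z ∈ S → Walk G S x z (suc k)
  walk-snoc (here y∈S)       y~z z∈S = step y∈S y~z (here z∈S)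
  walk-snoc (step x∈S x~y p) y~z z∈S = step x∈S x~y (walk-snoc p y~z z∈S)

  walk-reverse : ∀ {S x y k} → Walk G S x y k → Walk G S y x k
  walk-reverse (here x∈S)                   = here x∈S
  walk-reverse (step {x = x} {y} x∈S x~y p) = walk-snoc (walk-reverse p) (trans (adj-sym G y x) x~y) x∈S

  walk-⊤ : ∀ {S x y k} → Walk G S x y k → Walk G ⊤ x y k
  walk-⊤ (here _)       = here ∈⊤
  walk-⊤ (step _ x~y p) = step ∈⊤ x~y (walk-⊤ p)

  walk-split : ∀ {S x y} j k → Walk G S x y (j + k) → ∃ λ w → Walk G S x w j × Walk G S w y k
  walk-split zero    k p                = _ , here (walk-start p) , p
  walk-split (suc j) k (step x∈S x~y p) = let w , q , r = walk-split j k p in w , step x∈S x~y q , r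

  ball? : ∀ k (x y : V) → Dec (Ball G k x y)
  ball? zero x y = map′ (λ { refl → 0 , z≤n , here ∈⊤ }) (λ { (0 , z≤n , here _) → refl }) (x Fin.≟ y)
  ball? (suc k) x y = map′ to from (x Fin.≟ y ⊎-dec Fin.any? λ z → (adj G x z Bool.≟ true) ×-dec ball? k z y)
    where
    to : x ≡ y ⊎ (∃ λ z → adj G x z ≡ true × Ball G k z y) → Ball G (suc k) x y
    to (inj₁ refl)                      = 0 , z≤n , here ∈⊤
    to (inj₂ (z , x~z , m , m≤k , p))   = suc m , s≤s m≤k , step ∈⊤ x~z p
    from : Ball G (suc k) x y → x ≡ y ⊎ (∃ λ z → adj G x z ≡ true × Ball G k z y)
    from (0 , _ , here _)                 = inj₁ refl
    from (suc m , s≤s m≤k , step _ x~z p) = inj₂ (_ , x~z , m , m≤k , p)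

  -- Follow the walk while `cover` answers `P`. As `y` fails `P`, a first answer `Q` must come, and
  -- the edge leading to it splits the walk.
  walk-exit : ∀ {S x y k} {P Q : V → Set} → (∀ {w} → w ∈ S → P w ⊎ Q w) →
    Walk G S x y k → P x → ¬ P y → ∃ λ u → ∃ λ u′ → ∃ λ i → ∃ λ j →
    P u × Q u′ × adj G u u′ ≡ true × Walk G S x u i × Walk G S u′ y j × suc (i + j) ≡ k
  walk-exit cover (here _) Px ¬Py = contradiction Px ¬Py
  walk-exit cover (step x∈S x~z p) Px ¬Py with cover (walk-start p)
  ... | inj₂ Qz = _ , _ , 0 , _ , Px , Qz , x~z , here x∈S , p , refl
  ... | inj₁ Pz with walk-exit cover p Pz ¬Py
  ...   | u , u′ , i , j , Pu , Qu′ , u~u′ , q , r , eq =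
    u , u′ , suc i , j , Pu , Qu′ , u~u′ , step x∈S x~z q , r , cong suc eq

-- The distance of G, truncated at 2ℓ + 1.
module Distance (G : Graph) (ℓ : ℕ) where

  V : Set
  V = Fin (n G)

  private
    spec : ∀ (x y : V) → _
    spec x y = least (λ k → ball? {G} k x y) (suc (ℓ + ℓ))

  abstract
    d : V → V → ℕ
    d x y = proj₁ (spec x y)

    d≤bound : ∀ x y → d x y ≤ suc (ℓ + ℓ)
    d≤bound x y = proj₁ (proj₂ (spec x y))

    d-ball : ∀ x y → d x y ≤ ℓ + ℓ → Ball G (d x y) x y
    d-ball x y le = proj₁ (proj₂ (proj₂ (spec x y))) (s≤s le)

    ball-d : ∀ {k} x y → Ball G k x y → d x y ≤ k
    ball-d x y = proj₂ (proj₂ (proj₂ (spec x y))) _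

  d≤⇒ball : ∀ {k} x y → k ≤ ℓ + ℓ → d x y ≤ k → Ball G k x y
  d≤⇒ball x y k≤2ℓ d≤k = let m , m≤d , p = d-ball x y (≤-trans d≤k k≤2ℓ) in m , ≤-trans m≤d d≤k , p

  walk-d : ∀ {S k} x y → Walk G S x y k → d x y ≤ k
  walk-d x y p = ball-d x y (_ , ≤-refl , walk-⊤ p)

  d-walk : ∀ x y → d x y ≤ ℓ + ℓ → Walk G ⊤ x y (d x y)
  d-walk x y le = let m , m≤d , p = d-ball x y le in subst (Walk G ⊤ x y) (≤-antisym m≤d (walk-d x y p)) p

  d-refl : ∀ x → d x x ≡ 0
  d-refl x = n≤0⇒n≡0 (walk-d x x (here ∈⊤))

  d-adj : ∀ x y → adj G x y ≡ true → d x y ≤ 1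
  d-adj x y x~y = walk-d x y (step ∈⊤ x~y (here ∈⊤))

  private
    far-or-near : ∀ x y → d x y ≡ suc (ℓ + ℓ) ⊎ d x y ≤ ℓ + ℓ
    far-or-near x y with d x y ≤? ℓ + ℓ
    ... | yes le = inj₂ le
    ... | no ≰   = inj₁ (≤-antisym (d≤bound x y) (≰⇒> ≰))

  d-sym≤ : ∀ x y → d x y ≤ d y x
  d-sym≤ x y with far-or-near y x
  ... | inj₁ eq = ≤-trans (d≤bound x y) (≤-reflexive (sym eq))
  ... | inj₂ le = walk-d x y (walk-reverse (d-walk y x le))

  d-sym : ∀ x y → d x y ≡ d y x
  d-sym x y = ≤-antisym (d-sym≤ x y) (d-sym≤ y x)

  -- If a summand on the right equals the cap 2ℓ + 1, it bounds the left side; otherwise two walks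
  -- can be joined.
  d-triangle : ∀ x y z → d x z ≤ d x y + d y z
  d-triangle x y z with far-or-near x y | far-or-near y z
  ... | inj₁ eq | _       = ≤-trans (d≤bound x z) (≤-trans (≤-reflexive (sym eq)) (m≤m+n _ _))
  ... | inj₂ _  | inj₁ eq = ≤-trans (d≤bound x z) (≤-trans (≤-reflexive (sym eq)) (m≤n+m _ _))
  ... | inj₂ le | inj₂ le′ = walk-d x z (walk-++ (d-walk x y le) (d-walk y z le′))

  d-split : ∀ x y j k → d x y ≡ j + k → d x y ≤ ℓ + ℓ → ∃ λ w → d x w ≡ j × d w y ≡ k
  d-split x y j k eq le =
    let w , p , q = walk-split j k (subst (Walk G ⊤ x y) eq (d-walk x y le))
        w≤j = walk-d x w p
        w≤k = walk-d w y q
        ≤w  = ≤-trans (≤-reflexive (sym eq)) (d-triangle x w y)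
    in w , ≤-antisym w≤j (+-cancelʳ-≤ k j _ (≤-trans ≤w (+-monoʳ-≤ _ w≤k)))
         , ≤-antisym w≤k (+-cancelˡ-≤ j k _ (≤-trans ≤w (+-monoˡ-≤ _ w≤j)))

  -- v and v′ are the middle vertices of a geodesic; they coincide if its length is even.
  record Midpoints (x y v v′ : V) : Set where
    field
      h e   : ℕ
      e≤1   : e ≤ 1
      d-xy  : d x y ≡ h + (e + h)
      d-xv  : d x v ≡ h
      d-vv′ : d v v′ ≡ e
      d-v′y : d v′ y ≡ h

  -- Vertices are supplied for all pairs, with `x` as default beyond 2ℓ, because `sample` needs
  -- total functions before any distances are known.
  midpoints : ∀ x y → ∃ λ v → ∃ λ v′ → d x y ≤ ℓ + ℓ → Midpoints x y v v′
  midpoints x y with d x y ≤? ℓ + ℓ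
  ... | no ≰   = x , x , λ le → contradiction le ≰
  ... | yes le =
    let h , e , e≤1 , eq = halve (d x y)
        v , xv , vy = d-split x y h (e + h) eq le
        v′ , vv′ , v′y = d-split v y e h vy (≤-trans (≤-reflexive vy) (≤-trans (m≤n+m (e + h) h) (≤-trans (≤-reflexive (sym eq)) le)))
    in v , v′ , λ _ → record { h = h ; e = e ; e≤1 = e≤1 ; d-xy = eq ; d-xv = xv ; d-vv′ = vv′ ; d-v′y = v′y }

  Between : V → V → V → Set
  Between x w y = d x w + d w y ≡ d x y

  -- If z follows x on a shortest walk to y, then everything between z and y is also between x and
  -- y.
  geodesic : ∀ {S} x y → d x y ≤ ℓ + ℓ → (∀ w → Between x w y → w ∈ S) → Walk G S x y (d x y)
  geodesic {S} x y le = go (d x y) x refl (d-walk x y le)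
    where
    go : ∀ k x → d x y ≡ k → Walk G ⊤ x y k → (∀ w → Between x w y → w ∈ S) → Walk G S x y k
    go zero x _ (here _) S⊇ = here (S⊇ x (cong (_+ d x x) (d-refl x)))
    go (suc k) x eq (step {y = z} _ x~z p) S⊇ =
      step (S⊇ x (cong (_+ d x y) (d-refl x))) x~z (go k z zy≡k p S⊇′)
      where
      zy≡k : d z y ≡ k
      zy≡k = ≤-antisym (walk-d z y p)
        (s≤s⁻¹ (≤-trans (≤-reflexive (sym eq)) (≤-trans (d-triangle x z y) (+-monoˡ-≤ (d z y) (d-adj x z x~z)))))
      S⊇′ : ∀ w → Between z w y → w ∈ S
      S⊇′ w zwy = S⊇ w (≤-antisym
        (≤-trans (+-monoˡ-≤ (d w y) (≤-trans (d-triangle x z w) (+-monoˡ-≤ (d z w) (d-adj x z x~z))))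
          (≤-reflexive (trans (cong suc (trans zwy zy≡k)) (sym eq))))
        (d-triangle x w y))

-- Edges between sides of geodesics

module Crossing (G : Graph) (ℓ : ℕ) {I : Set} (_≟ᴵ_ : (i j : I) → Dec (i ≡ j)) (x : I → Fin (n G)) where

  open Distance G ℓ

  -- w lies on the half next to x i of a chosen geodesic from x i to x j of length
  -- 2h or 2h + 1, whose midpoints have distance more than ℓ to all other x k.
  record Side (i j : I) (w : V) : Set where
    field
      h    : ℕ
      i≢j  : i ≢ j
      s≤h  : d (x i) w ≤ h
      2h≤d : h + h ≤ d (x i) (x j)
      h≤ℓ  : h ≤ ℓ
      away : ∀ k → k ≢ i → k ≢ j → suc (ℓ + d (x i) w) ≤ d (x k) w + h

  private
    move : ∀ z w w′ → d w w′ ≤ 1 → d z w′ ≤ suc (d z w)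
    move z w w′ ww′ = ≤-trans (d-triangle z w w′) (≤-trans (+-monoʳ-≤ (d z w) ww′) (≤-reflexive (+-comm (d z w) 1)))

  -- The sides of i and k touch, and {i, k} is the pair of the geodesic through w only.
  crossing-one : ∀ {i k l w w′} a b → Side i k w → Side k l w′ → d w w′ ≤ 1 → d w′ w ≤ 1 → i ≢ l →
    a ≢ i → a ≢ k → b ≢ i → b ≢ k → ℓ + ℓ ≤ d (x a) w + d (x b) w′
  crossing-one {i} {k} {l} {w} {w′} a b S S′ ww′ w′w i≢l a≢i a≢k b≢i b≢k =
    result (d (x a) w) (d (x b) w′) (d (x b) w) s h h≤s (S.away a a≢i a≢k) (S.away b b≢i b≢k) (move (x b) w′ w w′w)
    where
    module S = Side S
    module S′ = Side S′
    s = d (x i) w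
    s′ = d (x k) w′
    h = S.h
    s′≤s : s′ ≤ s
    s′≤s = lemma s s′ (d (x i) w′) S′.h (S′.away i S.i≢j i≢l) (move (x i) w w′ ww′) S′.h≤ℓ
      where
      lemma : ∀ s s′ z h′ → suc (ℓ + s′) ≤ z + h′ → z ≤ suc s → h′ ≤ ℓ → s′ ≤ s
      lemma s s′ z h′ p q r = certify 0 (p ⊞ q ⊞ r) (solve (ℓ ∷ s ∷ s′ ∷ z ∷ h′ ∷ []))
    -- The way from x i to x k through w and w′ has length at most 2s + 1, so w is at least as far
    -- from x i as the midpoint. By `away`, both x a and x b are then more than ℓ away from w.
    h≤s : h ≤ s
    h≤s = half≤ h s (begin
      h + h                        ≤⟨ S.2h≤d ⟩
      d (x i) (x k)                ≤⟨ d-triangle (x i) w′ (x k) ⟩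
      d (x i) w′ + d w′ (x k)      ≤⟨ +-mono-≤ (move (x i) w w′ ww′) (≤-trans (≤-reflexive (d-sym w′ (x k))) s′≤s) ⟩
      suc (s + s)                  ∎)
      where open ≤-Reasoning
    result : ∀ da db db₀ s h → h ≤ s → suc (ℓ + s) ≤ da + h → suc (ℓ + s) ≤ db₀ + h → db₀ ≤ suc db → ℓ + ℓ ≤ da + db
    result da db db₀ s h p q r t = certify 1 (p ⊞ p ⊞ q ⊞ r ⊞ t) (solve (ℓ ∷ da ∷ db ∷ db₀ ∷ s ∷ h ∷ []))

  -- Both geodesics join x i and x k. Each of the two h is at most half their distance, which is at
  -- most s + s′ + 1, so adding the `away` conditions of a and b loses little.
  crossing-both : ∀ {i k w w′} a b → Side i k w → Side k i w′ → d w w′ ≤ 1 →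
    a ≢ i → a ≢ k → b ≢ i → b ≢ k → ℓ + ℓ ≤ d (x a) w + d (x b) w′
  crossing-both {i} {k} {w} {w′} a b S S′ ww′ a≢i a≢k b≢i b≢k =
    result (d (x a) w) (d (x b) w′) s s′ S.h S′.h (S.away a a≢i a≢k) (S′.away b b≢k b≢i) h+h′≤
    where
    module S = Side S
    module S′ = Side S′
    s = d (x i) w
    s′ = d (x k) w′
    D = d (x i) (x k)
    D≤ : D ≤ suc (s + s′)
    D≤ = ≤-trans (d-triangle (x i) w′ (x k)) (+-mono-≤ (move (x i) w w′ ww′) (≤-reflexive (d-sym w′ (x k))))
    h+h′≤ : S.h + S′.h ≤ suc (s + s′)
    h+h′≤ = ≤-trans (*-cancelˡ-≤ 2 (lemma S.h S′.h D S.2h≤d (≤-trans S′.2h≤d (≤-reflexive (d-sym (x k) (x i)))))) D≤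
      where
      lemma : ∀ h h′ D → h + h ≤ D → h′ + h′ ≤ D → 2 * (h + h′) ≤ 2 * D
      lemma h h′ D p q = certify 0 (p ⊞ q) (solve (h ∷ h′ ∷ D ∷ []))
    result : ∀ da db s s′ h h′ → suc (ℓ + s) ≤ da + h → suc (ℓ + s′) ≤ db + h′ → h + h′ ≤ suc (s + s′) → ℓ + ℓ ≤ da + db
    result da db s s′ h h′ p q r = certify 1 (p ⊞ q ⊞ r) (solve (ℓ ∷ da ∷ db ∷ s ∷ s′ ∷ h ∷ h′ ∷ []))

  -- The two outcomes of Ramsey's theorem. Where all distances are at most 2ℓ, the first means that
  -- they equal 2ℓ.
  Uniform : Set
  Uniform = (∀ i j → i ≢ j → ℓ + ℓ ≤ d (x i) (x j)) ⊎ (∀ i j → i ≢ j → d (x i) (x j) < ℓ + ℓ)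

  -- The sides of i and k touch although neither geodesic joins x i and x k.
  -- Then both geodesics have length 2ℓ and w, w′ are equally far from their ends.
  crossing-none : Uniform → ∀ {i j k l w w′} a b → Side i j w → Side k l w′ → d w w′ ≤ 1 → d w′ w ≤ 1 →
    i ≢ k → k ≢ j → i ≢ l → a ≢ b → ℓ + ℓ ≤ d (x a) w + d (x b) w′
  crossing-none uniform {i} {j} {k} {l} {w} {w′} a b S S′ ww′ w′w i≢k k≢j i≢l a≢b = conclude uniform
    where
    module S = Side S
    module S′ = Side S′
    s = d (x i) w
    s′ = d (x k) w′
    F : ℓ + s ≤ s′ + S.h
    F = s≤s⁻¹ (≤-trans (S.away k (i≢k ∘ sym) k≢j) (+-monoˡ-≤ S.h (move (x k) w′ w w′w)))
    F′ : ℓ + s′ ≤ s + S′.h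
    F′ = s≤s⁻¹ (≤-trans (S′.away i i≢k i≢l) (+-monoˡ-≤ S′.h (move (x i) w w′ ww′)))
    s≤s′ : s ≤ s′
    s≤s′ = lemma s s′ S.h F S.h≤ℓ
      where
      lemma : ∀ s s′ h → ℓ + s ≤ s′ + h → h ≤ ℓ → s ≤ s′
      lemma s s′ h p q = certify 0 (p ⊞ q) (solve (ℓ ∷ s ∷ s′ ∷ h ∷ []))
    s′≤s : s′ ≤ s
    s′≤s = lemma s s′ S′.h F′ S′.h≤ℓ
      where
      lemma : ∀ s s′ h′ → ℓ + s′ ≤ s + h′ → h′ ≤ ℓ → s′ ≤ s
      lemma s s′ h′ p q = certify 0 (p ⊞ q) (solve (ℓ ∷ s ∷ s′ ∷ h′ ∷ []))
    ℓ≤h : ℓ ≤ S.h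
    ℓ≤h = +-cancelˡ-≤ s ℓ S.h (≤-trans (≤-reflexive (+-comm s ℓ)) (≤-trans F (+-monoˡ-≤ S.h s′≤s)))
    conclude : Uniform → ℓ + ℓ ≤ d (x a) w + d (x b) w′
    conclude (inj₂ short) = contradiction (short i j S.i≢j) (≤⇒≯ (≤-trans (+-mono-≤ ℓ≤h ℓ≤h) S.2h≤d))
    -- Centres are 2ℓ apart, so x a is at least 2ℓ - s from w, unless a = i and the distance is s;
    -- likewise for b. If both exceptions occur, the way from x i to x k through w and w′ shows ℓ ≤
    -- s.
    conclude (inj₁ long) with i ≟ᴵ a | k ≟ᴵ b
    ... | yes refl | yes refl = +-mono-≤ ℓ≤s (≤-trans ℓ≤s s≤s′)
      where
      ℓ≤s : ℓ ≤ s
      ℓ≤s = half≤ ℓ s (≤-trans (long i k a≢b) (≤-trans (d-triangle (x i) w′ (x k))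
        (+-mono-≤ (move (x i) w w′ ww′) (≤-trans (≤-reflexive (d-sym w′ (x k))) s′≤s))))
    ... | yes refl | no k≢b = ≤-trans (long b k (k≢b ∘ sym)) (≤-trans (d-triangle (x b) w′ (x k))
      (≤-trans (≤-reflexive (trans (cong (d (x b) w′ +_) (d-sym w′ (x k))) (+-comm (d (x b) w′) s′))) (+-monoˡ-≤ (d (x b) w′) s′≤s)))
    ... | no i≢a | yes refl = ≤-trans (long a i (i≢a ∘ sym)) (≤-trans (d-triangle (x a) w (x i))
      (+-monoʳ-≤ (d (x a) w) (≤-trans (≤-reflexive (d-sym w (x i))) s≤s′)))
    ... | no i≢a | no k≢b = lemma (d (x a) w) (d (x b) w′) s s′
      (≤-trans (long a i (i≢a ∘ sym)) (≤-trans (d-triangle (x a) w (x i)) (≤-reflexive (cong (d (x a) w +_) (d-sym w (x i))))))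
      (≤-trans (long b k (k≢b ∘ sym)) (≤-trans (d-triangle (x b) w′ (x k)) (≤-reflexive (cong (d (x b) w′ +_) (d-sym w′ (x k))))))
      (≤-trans S.s≤h S.h≤ℓ) (≤-trans S′.s≤h S′.h≤ℓ)
      where
      lemma : ∀ da db s s′ → ℓ + ℓ ≤ da + s → ℓ + ℓ ≤ db + s′ → s ≤ ℓ → s′ ≤ ℓ → ℓ + ℓ ≤ da + db
      lemma da db s s′ p q r t = certify 0 (p ⊞ q ⊞ r ⊞ t) (solve (ℓ ∷ da ∷ db ∷ s ∷ s′ ∷ []))

  -- Four cases, according to whether the geodesic of w ends in x k and that of w′ in x i. The last
  -- one is `crossing-one` read from w′, with a and b exchanged.
  crossing : Uniform → ∀ {i j k l w w′} a b → Side i j w → Side k l w′ → adj G w w′ ≡ true → i ≢ k → a ≢ b →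
    (k ≡ j → a ≢ i × a ≢ j × b ≢ i × b ≢ j) → (i ≡ l → a ≢ l × a ≢ k × b ≢ l × b ≢ k) →
    ℓ + ℓ ≤ d (x a) w + d (x b) w′
  crossing uniform {i} {j} {k} {l} {w} {w′} a b S S′ w~w′ i≢k a≢b opp opp′
    with d-adj w w′ w~w′ | d-adj w′ w (trans (adj-sym G w′ w) w~w′) | k ≟ᴵ j | i ≟ᴵ l
  ... | ww′ | w′w | no k≢j | no i≢l = crossing-none uniform a b S S′ ww′ w′w i≢k k≢j i≢l a≢b
  ... | ww′ | w′w | yes refl | no i≢l =
    let a≢i , a≢k , b≢i , b≢k = opp refl in crossing-one a b S S′ ww′ w′w i≢l a≢i a≢k b≢i b≢k
  ... | ww′ | w′w | yes refl | yes refl =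
    let a≢i , a≢k , b≢i , b≢k = opp refl in crossing-both a b S S′ ww′ a≢i a≢k b≢i b≢k
  ... | ww′ | w′w | no k≢j | yes refl =
    let a≢i , a≢k , b≢i , b≢k = opp′ refl
    in ≤-trans (crossing-one b a S′ S w′w ww′ k≢j b≢k b≢i a≢k a≢i) (≤-reflexive (+-comm (d (x b) w′) (d (x a) w)))

-- Cardinalities of subsets

comprehension : ∀ {N} {P : Fin N → Set} → (∀ v → Dec (P v)) → Subset N
comprehension P? = Vec.tabulate λ v → does (P? v)

∈-comprehension⁺ : ∀ {N} {P : Fin N → Set} (P? : ∀ v → Dec (P v)) {v} → P v → v ∈ comprehension P?
∈-comprehension⁺ P? {v} Pv = Vec.lookup⇒[]= v _ (trans (Vec.lookup∘tabulate (λ v → does (P? v)) v) (dec-true (P? v) Pv))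

∈-comprehension⁻ : ∀ {N} {P : Fin N → Set} (P? : ∀ v → Dec (P v)) {v} → v ∈ comprehension P? → P v
∈-comprehension⁻ P? {v} v∈ with P? v | trans (sym (Vec.lookup∘tabulate (λ v → does (P? v)) v)) (Vec.[]=⇒lookup v∈)
... | yes Pv | _ = Pv

image? : ∀ {k N} (f : Fin k → Fin N) v → Dec (∃ λ i → f i ≡ v)
image? f v = Fin.any? λ i → f i Fin.≟ v

image : ∀ {k N} → (Fin k → Fin N) → Subset N
image f = comprehension (image? f)

∈-image : ∀ {k N} (f : Fin k → Fin N) i → f i ∈ image f
∈-image f i = ∈-comprehension⁺ (image? f) (i , refl)

∣∪∣≤ : ∀ {N} (p q : Subset N) → ∣ p ∪ q ∣ ≤ ∣ p ∣ + ∣ q ∣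
∣∪∣≤ Vec.[]            Vec.[]            = z≤n
∣∪∣≤ (true Vec.∷ p)  (true Vec.∷ q)  = s≤s (≤-trans (∣∪∣≤ p q) (+-monoʳ-≤ ∣ p ∣ (n≤1+n ∣ q ∣)))
∣∪∣≤ (true Vec.∷ p)  (false Vec.∷ q) = s≤s (∣∪∣≤ p q)
∣∪∣≤ (false Vec.∷ p) (true Vec.∷ q)  = ≤-trans (s≤s (∣∪∣≤ p q)) (≤-reflexive (sym (+-suc ∣ p ∣ ∣ q ∣)))
∣∪∣≤ (false Vec.∷ p) (false Vec.∷ q) = ∣∪∣≤ p q

∣image∣≤ : ∀ {k N} (f : Fin k → Fin N) → ∣ image f ∣ ≤ k
∣image∣≤ {zero} {N} f = ≤-trans (p⊆q⇒∣p∣≤∣q∣ {p = image f} {q = ⊥} λ v∈ → contradiction (proj₁ (∈-comprehension⁻ (image? f) v∈)) λ ()) (≤-reflexive (∣⊥∣≡0 N))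
∣image∣≤ {suc k} f = begin
  ∣ image f ∣                               ≤⟨ p⊆q⇒∣p∣≤∣q∣ sub ⟩
  ∣ ⁅ f zero ⁆ ∪ image (f ∘ suc) ∣          ≤⟨ ∣∪∣≤ ⁅ f zero ⁆ _ ⟩
  ∣ ⁅ f zero ⁆ ∣ + ∣ image (f ∘ suc) ∣      ≤⟨ +-mono-≤ (≤-reflexive (∣⁅x⁆∣≡1 (f zero))) (∣image∣≤ (f ∘ suc)) ⟩
  suc k                                     ∎
  where
  open ≤-Reasoning
  sub : image f ⊆ ⁅ f zero ⁆ ∪ image (f ∘ suc)
  sub v∈ with ∈-comprehension⁻ (image? f) v∈
  ... | zero  , refl = x∈p∪q⁺ (inj₁ (x∈⁅x⁆ (f zero)))
  ... | suc i , refl = x∈p∪q⁺ (inj₂ (∈-image (f ∘ suc) i))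

≤∣image∣ : ∀ {k N} (f : Fin k → Fin N) → (∀ i j → f i ≡ f j → i ≡ j) → k ≤ ∣ image f ∣
≤∣image∣ {zero}  f inj = z≤n
≤∣image∣ {suc k} f inj = <-≤-trans
  (s≤s (≤-trans (≤∣image∣ (f ∘ suc) λ i j eq → Fin.suc-injective (inj (suc i) (suc j) eq)) (p⊆q⇒∣p∣≤∣q∣ sub)))
  (x∈p⇒∣p-x∣<∣p∣ (∈-image f zero))
  where
  sub : image (f ∘ suc) ⊆ image f - f zero
  sub v∈ with ∈-comprehension⁻ (image? (f ∘ suc)) v∈
  ... | i , refl = x∈p∧x≢y⇒x∈p-y (∈-image f (suc i)) λ eq → contradiction (inj (suc i) zero eq) λ ()

-- The induced subgraph formed by a grid of geodesics

module Grid (G : Graph) (ℓ A J : ℕ) (x : Fin A ⊎ Fin J → Fin (n G)) where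

  I : Set
  I = Fin A ⊎ Fin J

  _≟ᴵ_ : (i j : I) → Dec (i ≡ j)
  _≟ᴵ_ = Sum.≡-dec Fin._≟_ Fin._≟_

  open Distance G ℓ
  open Crossing G ℓ _≟ᴵ_ x

  module _
    (m m′ : Fin A → Fin J → V)
    (mids : ∀ a b → Midpoints (x (inj₁ a)) (x (inj₂ b)) (m a b) (m′ a b))
    (short : ∀ a b → d (x (inj₁ a)) (x (inj₂ b)) ≤ ℓ + ℓ)
    (avoid : ∀ a b k → k ≢ inj₁ a → k ≢ inj₂ b → ℓ < d (m a b) (x k) × ℓ < d (m′ a b) (x k))
    (uniform : Uniform)
    (kept : Fin A → Fin J → Bool)
    where

    private
      xᴬ : Fin A → V
      xᴬ a = x (inj₁ a)
      xᴮ : Fin J → V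
      xᴮ b = x (inj₂ b)

    -- Whole intervals from the centres to the midpoints are taken instead of single paths: `side`
    -- applies to every vertex in them.
    OnGeodesic : V → Set
    OnGeodesic w = ∃ λ a → ∃ λ b → kept a b ≡ true × (Between (xᴬ a) w (m a b) ⊎ Between (xᴮ b) w (m′ a b))

    onGeodesic? : ∀ w → Dec (OnGeodesic w)
    onGeodesic? w = Fin.any? λ a → Fin.any? λ b → (kept a b Bool.≟ true) ×-dec ((_ ≟ _) ⊎-dec (_ ≟ _))

    S : Subset (n G)
    S = comprehension onGeodesic?

    S-left : ∀ {a b w} → kept a b ≡ true → Between (xᴬ a) w (m a b) → w ∈ S
    S-left ab btw = ∈-comprehension⁺ onGeodesic? (_ , _ , ab , inj₁ btw)

    S-right : ∀ {a b w} → kept a b ≡ true → Between (xᴮ b) w (m′ a b) → w ∈ S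
    S-right ab btw = ∈-comprehension⁺ onGeodesic? (_ , _ , ab , inj₂ btw)

    between-start : ∀ y z → Between y y z
    between-start y z = cong (_+ d y z) (d-refl y)

    between-end : ∀ y z → Between y z z
    between-end y z = trans (cong (d y z +_) (d-refl z)) (+-identityʳ (d y z))

    kept-near : ∀ a b → kept a b ≡ true → InBall G S (xᴮ b) (ℓ + ℓ) (xᴬ a)
    kept-near a b ab = _ , short′ , walk-reverse (walk-++ first (walk-++ second third))
      where
      module M = Midpoints (mids a b)
      total : d (xᴬ a) (m a b) + (d (m a b) (m′ a b) + d (m′ a b) (xᴮ b)) ≡ d (xᴬ a) (xᴮ b)
      total = trans (cong₂ _+_ M.d-xv (cong₂ _+_ M.d-vv′ M.d-v′y)) (sym M.d-xy)
      short′ = ≤-trans (≤-reflexive total) (short a b)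
      first : Walk G S (xᴬ a) (m a b) (d (xᴬ a) (m a b))
      first = geodesic _ _ (≤-trans (m≤m+n _ _) short′) λ w → S-left ab
      third : Walk G S (m′ a b) (xᴮ b) (d (m′ a b) (xᴮ b))
      third = geodesic _ _ (≤-trans (m≤n+m _ (d (m a b) (m′ a b))) (≤-trans (m≤n+m _ (d (xᴬ a) (m a b))) short′)) λ w btw → S-right ab
        (trans (cong₂ _+_ (d-sym (xᴮ b) w) (d-sym w (m′ a b))) (trans (+-comm (d w (xᴮ b)) _) (trans btw (d-sym (m′ a b) (xᴮ b)))))
      d≡0⇒≡ : ∀ y z → d y z ≡ 0 → y ≡ z
      d≡0⇒≡ y z eq with subst (Walk G ⊤ y z) eq (d-walk y z (≤-trans (≤-reflexive eq) z≤n))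
      ... | here _ = refl
      -- The midpoints have distance at most 1, so only they themselves lie between them.
      endpoint : ∀ w → Between (m a b) w (m′ a b) → w ∈ S
      endpoint w btw with d (m a b) w in eq | d w (m′ a b) in eq′
      ... | zero  | _     = subst (_∈ S) (d≡0⇒≡ _ _ eq) (S-left ab (between-end (xᴬ a) (m a b)))
      ... | suc _ | zero  = subst (_∈ S) (sym (d≡0⇒≡ _ _ eq′)) (S-right ab (between-end (xᴮ b) (m′ a b)))
      ... | suc p | suc q = contradiction (≤-trans (≤-reflexive (trans btw M.d-vv′)) M.e≤1) λ { (s≤s le) → contradiction (≤-trans (m≤n+m (suc q) p) le) λ () }
      second : Walk G S (m a b) (m′ a b) (d (m a b) (m′ a b))
      second = geodesic _ _ (≤-trans (m≤m+n _ (d (m′ a b) (xᴮ b))) (≤-trans (m≤n+m _ (d (xᴬ a) (m a b))) short′)) endpoint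

    -- The condition `away` is the triangle inequality through w: x k is more than ℓ from v, and w
    -- is only h - d (x i) w from v.
    side : ∀ i j w v h → i ≢ j → d (x i) v ≡ h → h + h ≤ d (x i) (x j) → d (x i) (x j) ≤ ℓ + ℓ →
      (∀ k → k ≢ i → k ≢ j → ℓ < d v (x k)) → Between (x i) w v → Side i j w
    side i j w v h i≢j xv≡h 2h≤d d≤2ℓ far btw = record
      { h = h ; i≢j = i≢j ; 2h≤d = 2h≤d
      ; s≤h = ≤-trans (m≤m+n _ (d w v)) (≤-reflexive btw′)
      ; h≤ℓ = half≤ h ℓ (≤-trans 2h≤d (≤-trans d≤2ℓ (n≤1+n _)))
      ; away = λ k k≢i k≢j → lemma (d (x i) w) (d w v) (d (x k) w)
          (≤-trans (far k k≢i k≢j) (≤-trans (d-triangle v w (x k)) (≤-reflexive (cong₂ _+_ (d-sym v w) (d-sym w (x k))))))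
          (≤-reflexive btw′)
      }
      where
      btw′ : d (x i) w + d w v ≡ h
      btw′ = trans btw xv≡h
      lemma : ∀ s r z → suc ℓ ≤ r + z → s + r ≤ h → suc (ℓ + s) ≤ z + h
      lemma s r z p q = certify 0 (p ⊞ q) (solve (ℓ ∷ s ∷ r ∷ z ∷ h ∷ []))

    sideᴬ : ∀ a b w → Between (xᴬ a) w (m a b) → Side (inj₁ a) (inj₂ b) w
    sideᴬ a b w = side _ _ w (m a b) M.h (λ ()) M.d-xv
      (≤-trans (+-monoʳ-≤ M.h (m≤n+m M.h M.e)) (≤-reflexive (sym M.d-xy))) (short a b)
      (λ k k≢a k≢b → proj₁ (avoid a b k k≢a k≢b))
      where module M = Midpoints (mids a b)

    sideᴮ : ∀ a b w → Between (xᴮ b) w (m′ a b) → Side (inj₂ b) (inj₁ a) w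
    sideᴮ a b w = side _ _ w (m′ a b) M.h (λ ()) (trans (d-sym (xᴮ b) (m′ a b)) M.d-v′y)
      (≤-trans (+-monoʳ-≤ M.h (m≤n+m M.h M.e)) (≤-reflexive (trans (sym M.d-xy) (d-sym (xᴬ a) (xᴮ b)))))
      (≤-trans (≤-reflexive (d-sym (xᴮ b) (xᴬ a))) (short a b))
      (λ k k≢b k≢a → proj₂ (avoid a b k k≢a k≢b))
      where module M = Midpoints (mids a b)

    Pair : I → I → Set
    Pair (inj₁ a) (inj₂ b) = kept a b ≡ true
    Pair (inj₂ b) (inj₁ a) = kept a b ≡ true
    Pair _        _        = Empty.⊥

    pair-sym : ∀ i j → Pair i j → Pair j i
    pair-sym (inj₁ a) (inj₂ b) p = p
    pair-sym (inj₂ b) (inj₁ a) p = p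

    -- A short walk from x_b₀ to x_a₀ would have to leave the sides of b₀ and of the
    -- a ≠ a₀ along an edge to the sides of a₀ and of the b ≠ b₀, against crossing.
    module _ (a₀ : Fin A) (b₀ : Fin J) (unkept : kept a₀ b₀ ≡ false) (a₁ : Fin A) (kept₁ : kept a₁ b₀ ≡ true) where

      Inner Outer : I → Set
      Inner (inj₁ a) = a ≢ a₀
      Inner (inj₂ b) = b ≡ b₀
      Outer (inj₁ a) = a ≡ a₀
      Outer (inj₂ b) = b ≢ b₀

      In Out : V → Set
      In  w = ∃ λ i → ∃ λ j → Inner i × Pair i j × Side i j w
      Out w = ∃ λ i → ∃ λ j → Outer i × Pair i j × Side i j w

      cover : ∀ {w} → w ∈ S → In w ⊎ Out w
      cover {w} w∈S with ∈-comprehension⁻ onGeodesic? w∈S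
      ... | a , b , ab , inj₁ btw with a Fin.≟ a₀
      ...   | yes a≡a₀ = inj₂ (_ , _ , a≡a₀ , ab , sideᴬ a b w btw)
      ...   | no a≢a₀  = inj₁ (_ , _ , a≢a₀ , ab , sideᴬ a b w btw)
      cover {w} w∈S | a , b , ab , inj₂ btw with b Fin.≟ b₀
      ...   | yes b≡b₀ = inj₁ (_ , _ , b≡b₀ , ab , sideᴮ a b w btw)
      ...   | no b≢b₀  = inj₂ (_ , _ , b≢b₀ , ab , sideᴮ a b w btw)

      start : In (xᴮ b₀)
      start = _ , _ , refl , kept₁ , sideᴮ a₁ b₀ (xᴮ b₀) (between-start _ _)

      clash : ∀ {a} → kept a b₀ ≡ true → a ≢ a₀
      clash ab refl = contradiction (trans (sym ab) unkept) λ ()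

      -- At the centre itself, `away` would give ℓ < h, although h ≤ ℓ.
      not-end : ∀ i j → inj₁ a₀ ≢ i → inj₁ a₀ ≢ j → Side i j (xᴬ a₀) → Empty.⊥
      not-end i j a₀≢i a₀≢j s = contradiction
        (≤-trans (away (inj₁ a₀) a₀≢i a₀≢j) (≤-trans (≤-reflexive (cong (_+ h) (d-refl (xᴬ a₀)))) h≤ℓ))
        (<⇒≱ (s≤s (m≤m+n ℓ _)))
        where open Side s

      end : ¬ In (xᴬ a₀)
      end (inj₁ a , inj₂ b , a≢a₀ , _ , s) = not-end _ _ (λ { refl → a≢a₀ refl }) (λ ()) s
      end (inj₂ b , inj₁ a , refl , ab , s) = not-end _ _ (λ ()) (λ { refl → clash ab refl }) s

      inner≢outer : ∀ {i k} → Inner i → Outer k → i ≢ k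
      inner≢outer {inj₁ _} i k refl = i k
      inner≢outer {inj₂ _} i k refl = k i

      -- A kept pair of an inner and an outer index avoids a₀ and b₀, since the only alternative is
      -- the unkept pair of a₀ and b₀. This is what `crossing` asks for when a geodesic joins the
      -- two ends in question.
      opposite : ∀ i j → Inner i → Outer j → Pair i j → inj₂ b₀ ≢ i × inj₂ b₀ ≢ j × inj₁ a₀ ≢ i × inj₁ a₀ ≢ j
      opposite (inj₁ a) (inj₂ b) a≢ b≢ _  = (λ ()) , (λ { refl → b≢ refl }) , (λ { refl → a≢ refl }) , λ ()
      opposite (inj₂ b) (inj₁ a) refl refl ab = contradiction refl (clash ab)

      unkept-far : ¬ InBall G S (xᴮ b₀) (ℓ + ℓ) (xᴬ a₀)
      unkept-far (k , k≤2ℓ , p) with walk-exit {P = In} {Q = Out} cover p start end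
      ... | u , u′ , s , t , (i , j , in-i , ij , side-u) , (i′ , j′ , out-i′ , ij′ , side-u′) , u~u′ , q , r , eq =
        contradiction (begin
          suc (ℓ + ℓ)                          ≤⟨ s≤s far ⟩
          suc (d (xᴮ b₀) u + d (xᴬ a₀) u′)     ≤⟨ s≤s (+-mono-≤ (walk-d _ _ q) (≤-trans (≤-reflexive (d-sym (xᴬ a₀) u′)) (walk-d _ _ r))) ⟩
          suc (s + t)                          ≡⟨ eq ⟩
          k                                    ≤⟨ k≤2ℓ ⟩
          ℓ + ℓ                                ∎) (<⇒≱ ≤-refl)
        where
        open ≤-Reasoning
        far : ℓ + ℓ ≤ d (xᴮ b₀) u + d (xᴬ a₀) u′
        far = crossing uniform (inj₂ b₀) (inj₁ a₀) side-u side-u′ u~u′ (inner≢outer in-i out-i′) (λ ())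
          (λ { refl → opposite i j in-i out-i′ ij })
          (λ { refl → opposite i i′ in-i out-i′ (pair-sym i′ i ij′) })

-- Random centres with midpoints outside all other balls

-- A random tuple works, by a union bound over all i, j, k and s.
sample : ∀ {C V} (R : Fin C → Fin V → Bool) N P (pt : Fin P → Fin C → Fin C → Fin V) Q → N * (N * (N * P)) < Q →
  (w : Fin C → ℕ) → 0 < sum w → (∀ v → Q * sum (λ c → w c * ind (R c v)) ≤ sum w) →
  ∃ λ (us : Vec (Fin C) N) → ∀ i j k s → k ≢ i → k ≢ j → R (lookup us k) (pt s (lookup us i) (lookup us j)) ≡ false
sample {C} {V} R N P pt Q Q-large w W>0 light = us , λ i j k s k≢i k≢j → avoids i j k s k≢i k≢j
  where
  event : Fin N → Fin N → Fin N → Fin P → Vec (Fin C) N → ℕ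
  event i j k s us with k Fin.≟ i | k Fin.≟ j
  ... | yes _ | _     = 0
  ... | no _  | yes _ = 0
  ... | no _  | no _  = ind (R (lookup us k) (pt s (lookup us i) (lookup us j)))
  never : Q * sum (λ c → w c * 0) ≤ sum w
  never = ≤-trans (≤-reflexive (trans (cong (Q *_) (trans (sum-cong-≗ λ c → *-zeroʳ (w c)) (trans (sum-const C 0) (*-zeroʳ C)))) (*-zeroʳ Q))) z≤n
  event-rare : ∀ i j k s us → Q * sum (λ c → w c * event i j k s (us [ k ]≔ c)) ≤ sum w
  event-rare i j k s us with k Fin.≟ i | k Fin.≟ j
  ... | yes _  | _      = never
  ... | no _   | yes _  = never
  -- Resampling the k-th centre leaves the point chosen for i and j fixed, so `light` applies to it.
  ... | no k≢i | no k≢j = ≤-trans (≤-reflexive (cong (Q *_) (sum-cong-≗ λ c → cong (λ b → w c * ind b)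
    (trans (cong₂ (λ a b → R (lookup (us [ k ]≔ c) k) (pt s a b)) (Vec.lookup∘update′ (k≢i ∘ sym) us c) (Vec.lookup∘update′ (k≢j ∘ sym) us c))
      (cong (λ a → R a _) (Vec.lookup∘update k us c)))))) (light (pt s (lookup us i) (lookup us j)))
  avoided = rare-avoid w Q N {t = N * (N * (N * (P * 1)))} W>0
    (subst (λ z → N * (N * (N * z)) < Q) (sym (*-identityʳ P)) Q-large)
    (rare-sum w Q N (λ i us → sum λ j → sum λ k → sum λ s → event i j k s us) λ i →
      rare-sum w Q N (λ j us → sum λ k → sum λ s → event i j k s us) λ j →
        rare-sum w Q N (λ k us → sum λ s → event i j k s us) λ k →
          rare-sum w Q N (event i j k) λ s → rare-coordinate w Q N k (event i j k s) (event-rare i j k s))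
  us = proj₁ avoided
  event≡0 : ∀ i j k s → event i j k s us ≡ 0
  event≡0 i j k s = n≤0⇒n≡0 (begin
    event i j k s us                                              ≤⟨ term≤sum (λ s → event i j k s us) s ⟩
    sum (λ s → event i j k s us)                                  ≤⟨ term≤sum (λ k → sum λ s → event i j k s us) k ⟩
    sum (λ k → sum λ s → event i j k s us)                        ≤⟨ term≤sum (λ j → sum λ k → sum λ s → event i j k s us) j ⟩
    sum (λ j → sum λ k → sum λ s → event i j k s us)              ≤⟨ term≤sum (λ i → sum λ j → sum λ k → sum λ s → event i j k s us) i ⟩
    sum (λ i → sum λ j → sum λ k → sum λ s → event i j k s us)    ≡⟨ proj₂ avoided ⟩
    0                                                             ∎)
    where open ≤-Reasoning
  avoids : ∀ i j k s → k ≢ i → k ≢ j → R (lookup us k) (pt s (lookup us i) (lookup us j)) ≡ false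
  avoids i j k s k≢i k≢j with k Fin.≟ i | k Fin.≟ j | event≡0 i j k s
  ... | yes k≡i | _       | _ = contradiction k≡i k≢i
  ... | no _    | yes k≡j | _ = contradiction k≡j k≢j
  ... | no _    | no _    | e with R (lookup us k) (pt s (lookup us i) (lookup us j))
  ...   | false = refl

-- Ramsey's theorem

module _ {A : Set} {P : A → A → Set} (P? : ∀ x y → Dec (P x y)) where

  length-filter-split : ∀ x xs → length (filter (P? x) xs) + length (filter (¬? ∘ P? x) xs) ≡ length xs
  length-filter-split x []       = refl
  length-filter-split x (y ∷ ys) with P? x y
  ... | yes _ = cong suc (length-filter-split x ys)
  ... | no _  = trans (+-suc _ _) (cong suc (length-filter-split x ys))

  -- Each step keeps the head and either enough elements related to it or enough unrelated ones. `R`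
  -- is carried along to record that the elements are distinct.
  ramsey-list : ∀ {R : A → A → Set} a b xs → 2 ^ (a + b) ≤ length xs → AllPairs R xs →
    (∃ λ ys → length ys ≡ a × (∀ {y} → y ∈ˡ ys → y ∈ˡ xs) × AllPairs (λ x y → R x y × P x y) ys) ⊎
    (∃ λ ys → length ys ≡ b × (∀ {y} → y ∈ˡ ys → y ∈ˡ xs) × AllPairs (λ x y → R x y × ¬ P x y) ys)
  ramsey-list zero    b       xs _ _ = inj₁ ([] , refl , (λ ()) , AllPairs.[])
  ramsey-list (suc a) zero    xs _ _ = inj₂ ([] , refl , (λ ()) , AllPairs.[])
  ramsey-list (suc a) (suc b) [] le _ = contradiction (≤-trans (m^n>0 2 (suc a + suc b)) le) λ ()
  ramsey-list {R} (suc a) (suc b) (x ∷ xs) le (Rx AllPairs.∷ Rxs) with 2 ^ (a + suc b) ≤? length (filter (P? x) xs)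
  ... | yes many with ramsey-list a (suc b) (filter (P? x) xs) many (AllPairs.filter⁺ (P? x) Rxs)
  ...   | inj₂ (ys , eq , sub , pairs) = inj₂ (ys , eq , (λ y∈ → Any.there (proj₁ (∈-filter⁻ (P? x) (sub y∈)))) , pairs)
  ...   | inj₁ (ys , eq , sub , pairs) = inj₁ (x ∷ ys , cong suc eq ,
    (λ { (Any.here y≡x) → Any.here y≡x ; (Any.there y∈) → Any.there (proj₁ (∈-filter⁻ (P? x) (sub y∈))) }) ,
    All.tabulate (λ y∈ → let y∈xs , Pxy = ∈-filter⁻ (P? x) (sub y∈) in All.lookup Rx y∈xs , Pxy) AllPairs.∷ pairs)
  ramsey-list {R} (suc a) (suc b) (x ∷ xs) le (Rx AllPairs.∷ Rxs) | no few
    with ramsey-list (suc a) b (filter (¬? ∘ P? x) xs) many (AllPairs.filter⁺ (¬? ∘ P? x) Rxs)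
    where
    lemma : ∀ h y z l → h + (h + 0) ≤ suc l → y + z ≡ l → suc y ≤ h → h ≤ z
    lemma h y z l p q r = certify 0 (p ⊞ ≤-reflexive (sym q) ⊞ r) (solve (h ∷ y ∷ z ∷ l ∷ []))
    -- The strict bound on the related elements makes up for the removed head.
    many : 2 ^ (suc a + b) ≤ length (filter (¬? ∘ P? x) xs)
    many = subst (λ e → 2 ^ e ≤ length (filter (¬? ∘ P? x) xs)) (+-suc a b)
      (lemma (2 ^ (a + suc b)) (length (filter (P? x) xs)) _ (length xs) le (length-filter-split x xs) (≰⇒> few))
  ...   | inj₁ (ys , eq , sub , pairs) = inj₁ (ys , eq , (λ y∈ → Any.there (proj₁ (∈-filter⁻ (¬? ∘ P? x) (sub y∈)))) , pairs)
  ...   | inj₂ (ys , eq , sub , pairs) = inj₂ (x ∷ ys , cong suc eq ,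
    (λ { (Any.here y≡x) → Any.here y≡x ; (Any.there y∈) → Any.there (proj₁ (∈-filter⁻ (¬? ∘ P? x) (sub y∈))) }) ,
    All.tabulate (λ y∈ → let y∈xs , ¬Pxy = ∈-filter⁻ (¬? ∘ P? x) (sub y∈) in All.lookup Rx y∈xs , ¬Pxy) AllPairs.∷ pairs)

lookup-pairs : ∀ {A : Set} {R : A → A → Set} → (∀ {x y} → R x y → R y x) → ∀ {xs} → AllPairs R xs →
  ∀ i j → i ≢ j → R (List.lookup xs i) (List.lookup xs j)
lookup-pairs R-sym (Rx AllPairs.∷ Rxs) zero    zero    i≢j = contradiction refl i≢j
lookup-pairs R-sym (Rx AllPairs.∷ Rxs) zero    (suc j) i≢j = All.lookup Rx (∈-lookup j)
lookup-pairs R-sym (Rx AllPairs.∷ Rxs) (suc i) zero    i≢j = R-sym (lookup-pairs R-sym (Rx AllPairs.∷ Rxs) zero (suc i) λ ())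
lookup-pairs R-sym (Rx AllPairs.∷ Rxs) (suc i) (suc j) i≢j = lookup-pairs R-sym Rxs i j λ { refl → i≢j refl }

ramsey : ∀ {N} {P : Fin N → Fin N → Set} → (∀ i j → Dec (P i j)) → (∀ {i j} → P i j → P j i) → ∀ a b → 2 ^ (a + b) ≤ N →
  (∃ λ (e : Fin a → Fin N) → ∀ i j → i ≢ j → e i ≢ e j × P (e i) (e j)) ⊎
  (∃ λ (e : Fin b → Fin N) → ∀ i j → i ≢ j → e i ≢ e j × ¬ P (e i) (e j))
ramsey {N} P? P-sym a b large
  with ramsey-list P? a b (allFin N) (≤-trans large (≤-reflexive (sym (length-tabulate {n = N} id)))) (Unique.allFin⁺ N)
... | inj₁ (ys , refl , _ , pairs) = inj₁ (List.lookup ys , lookup-pairs (λ { (≢ , p) → ≢ ∘ sym , P-sym p }) pairs)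
... | inj₂ (ys , refl , _ , pairs) = inj₂ (List.lookup ys , lookup-pairs (λ { (≢ , ¬p) → ≢ ∘ sym , ¬p ∘ P-sym }) pairs)

-- Heavy vertices of the ball hypergraph

does-true : ∀ {P : Set} (P? : Dec P) → does P? ≡ true → P
does-true (yes p) _ = p

does-false : ∀ {P : Set} (P? : Dec P) → does P? ≡ false → ¬ P
does-false (no ¬p) _ = ¬p

module Balls (G : Graph) (ℓ : ℕ) where

  open Distance G ℓ

  inBall? : (c v : V) → Dec (d c v ≤ ℓ)
  inBall? c v = d c v ≤? ℓ

  ballᵇ : V → V → Bool
  ballᵇ c v = does (inBall? c v)

  ballᵇ-sound : ∀ {c v} → ballᵇ c v ≡ true → Ball G ℓ c v
  ballᵇ-sound {c} {v} eq = d≤⇒ball c v (m≤m+n ℓ ℓ) (does-true (inBall? c v) eq)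

  ballᵇ-complete : ∀ {c v} → Ball G ℓ c v → ballᵇ c v ≡ true
  ballᵇ-complete {c} {v} in-ball = dec-true (inBall? c v) (ball-d c v in-ball)

  ballᵇ-false : ∀ {c v} → ballᵇ c v ≡ false → ℓ < d c v
  ballᵇ-false {c} {v} eq = ≰⇒> (does-false (inBall? c v) eq)

  shatters⇒shattered : ∀ k → Shatters ballᵇ k → ∃ λ X → Shattered G ⊤ X × k ≤ ∣ X ∣
  shatters⇒shattered k (y , realize) = image y , ((λ _ → ∈⊤) , cut) , ≤∣image∣ y y-injective
    where
    y-injective : ∀ i j → y i ≡ y j → i ≡ j
    y-injective i j eq with realize (λ k → does (k Fin.≟ i))
    ... | c , eqs with j Fin.≟ i | trans (sym (eqs j)) (trans (cong (ballᵇ c) (sym eq)) (trans (eqs i) (dec-true (i Fin.≟ i) refl)))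
    ...   | yes j≡i | _ = sym j≡i
    cut : ∀ X′ → X′ ⊆ image y → Σ V λ v → Σ ℕ λ k → v ∈ ⊤ ×
      (∀ x → x ∈ image y → (InBall G ⊤ v k x → x ∈ X′) × (x ∈ X′ → InBall G ⊤ v k x))
    cut X′ _ with realize (λ i → does (y i ∈? X′))
    ... | c , eqs = c , ℓ , ∈⊤ , λ x x∈ → correct x (∈-comprehension⁻ (image? y) x∈)
      where
      correct : ∀ x → (∃ λ i → y i ≡ x) → (Ball G ℓ c x → x ∈ X′) × (x ∈ X′ → Ball G ℓ c x)
      correct _ (i , refl) = to , λ yi∈ → ballᵇ-sound (trans (eqs i) (dec-true (y i ∈? X′) yi∈))
        where
        to : Ball G ℓ c (y i) → y i ∈ X′
        to in-ball with y i ∈? X′ | trans (sym (eqs i)) (ballᵇ-complete in-ball)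
        ... | yes yi∈ | _ = yi∈

  far⇒packing : ∀ k (y : Fin k → V) → (∀ i j → i ≢ j → ℓ + ℓ < d (y i) (y j)) → ∃ λ C → Packing G ℓ C × k ≤ ∣ C ∣
  far⇒packing k y far = image y , disjoint , ≤∣image∣ y y-injective
    where
    y-injective : ∀ i j → y i ≡ y j → i ≡ j
    y-injective i j eq with i Fin.≟ j
    ... | yes i≡j = i≡j
    ... | no i≢j  = contradiction (≤-trans (far i j i≢j) (≤-reflexive (trans (cong (d (y i)) (sym eq)) (d-refl (y i))))) λ ()
    disjoint : Packing G ℓ (image y)
    disjoint u v u∈ v∈ u≢v z (uz , vz) with ∈-comprehension⁻ (image? y) u∈ | ∈-comprehension⁻ (image? y) v∈
    ... | i , refl | j , refl = contradiction (far i j λ { refl → u≢v refl }) (≤⇒≯ (≤-trans (d-triangle (y i) z (y j))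
      (+-mono-≤ (ball-d (y i) z uz) (≤-trans (≤-reflexive (d-sym z (y j))) (ball-d (y j) z vz)))))

  μ μ′ : V → V → V
  μ y z = proj₁ (midpoints y z)
  μ′ y z = proj₁ (proj₂ (midpoints y z))

  midpoint : Fin 2 → V → V → V
  midpoint zero    = μ
  midpoint (suc _) = μ′

  -- An extra row of the grid, kept with all columns, makes sure that the column for
  -- the empty set lies on some kept geodesic.
  grid⇒shattered : ∀ k (x : Fin (suc k) ⊎ Fin (2 ^ k) → V) →
    (∀ i j → i ≢ j → d (x i) (x j) ≤ ℓ + ℓ) →
    (∀ i j k s → k ≢ i → k ≢ j → ℓ < d (midpoint s (x i) (x j)) (x k)) →
    (∀ i j → i ≢ j → ℓ + ℓ ≤ d (x i) (x j)) ⊎ (∀ i j → i ≢ j → d (x i) (x j) < ℓ + ℓ) →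
    ∃ λ S → ∃ λ X → Shattered G S X × k ≤ ∣ X ∣
  grid⇒shattered k x short avoid uniform = S′ , image y , (sub , cut) , ≤∣image∣ y y-injective
    where
    open Grid G ℓ (suc k) (2 ^ k) x
    kept : Fin (suc k) → Fin (2 ^ k) → Bool
    kept zero    b = true
    kept (suc a) b = mem b a
    short′ : ∀ a b → d (x (inj₁ a)) (x (inj₂ b)) ≤ ℓ + ℓ
    short′ a b = short _ _ λ ()
    m m′ : Fin (suc k) → Fin (2 ^ k) → V
    m a b = μ (x (inj₁ a)) (x (inj₂ b))
    m′ a b = μ′ (x (inj₁ a)) (x (inj₂ b))
    mids : ∀ a b → Midpoints (x (inj₁ a)) (x (inj₂ b)) (m a b) (m′ a b)
    mids a b = proj₂ (proj₂ (midpoints (x (inj₁ a)) (x (inj₂ b)))) (short′ a b)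
    avoid′ : ∀ a b k → k ≢ inj₁ a → k ≢ inj₂ b → ℓ < d (m a b) (x k) × ℓ < d (m′ a b) (x k)
    avoid′ a b k k≢a k≢b = avoid _ _ k zero k≢a k≢b , avoid _ _ k (suc zero) k≢a k≢b
    S′ : Subset (n G)
    S′ = S m m′ mids short′ avoid′ uniform kept
    y : Fin k → V
    y a = x (inj₁ (suc a))
    near : ∀ a b → mem b a ≡ true → InBall G S′ (x (inj₂ b)) (ℓ + ℓ) (y a)
    near a b = kept-near m m′ mids short′ avoid′ uniform kept (suc a) b
    far : ∀ a b → mem b a ≡ false → ¬ InBall G S′ (x (inj₂ b)) (ℓ + ℓ) (y a)
    far a b unkept = unkept-far m m′ mids short′ avoid′ uniform kept (suc a) b unkept zero refl
    sub : image y ⊆ S′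
    sub v∈ with ∈-comprehension⁻ (image? y) v∈
    ... | a , refl = S-left m m′ mids short′ avoid′ uniform kept {a = suc a} {b = subset {k} (λ _ → true)} (mem-subset {k} (λ _ → true) a)
      (between-start m m′ mids short′ avoid′ uniform kept _ _)
    y-injective : ∀ i j → y i ≡ y j → i ≡ j
    -- The column of the singleton of i is near `y i` but far from every other `y j`.
    y-injective i j eq with j Fin.≟ i | mem-subset (λ a → does (a Fin.≟ i)) j
    ... | yes j≡i | _   = sym j≡i
    ... | no  _   | out = contradiction
      (subst (InBall G S′ (x (inj₂ (subset λ a → does (a Fin.≟ i)))) (ℓ + ℓ)) eq
        (near i (subset λ a → does (a Fin.≟ i)) (trans (mem-subset (λ a → does (a Fin.≟ i)) i) (dec-true (i Fin.≟ i) refl))))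
      (far j (subset λ a → does (a Fin.≟ i)) out)
    cut : ∀ X′ → X′ ⊆ image y → Σ V λ v → Σ ℕ λ r → v ∈ S′ ×
      (∀ z → z ∈ image y → (InBall G S′ v r z → z ∈ X′) × (z ∈ X′ → InBall G S′ v r z))
    cut X′ _ = x (inj₂ b) , ℓ + ℓ , b∈S , λ z z∈ → correct z (∈-comprehension⁻ (image? y) z∈)
      where
      b : Fin (2 ^ k)
      b = subset λ a → does (y a ∈? X′)
      b∈S : x (inj₂ b) ∈ S′
      b∈S = S-right m m′ mids short′ avoid′ uniform kept {a = zero} refl (between-start m m′ mids short′ avoid′ uniform kept _ _)
      correct : ∀ z → (∃ λ a → y a ≡ z) → (InBall G S′ (x (inj₂ b)) (ℓ + ℓ) z → z ∈ X′) × (z ∈ X′ → InBall G S′ (x (inj₂ b)) (ℓ + ℓ) z)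
      correct _ (a , refl) = to , λ ya∈ → near a b (trans (mem-subset (λ a → does (y a ∈? X′)) a) (dec-true (y a ∈? X′) ya∈))
        where
        to : InBall G S′ (x (inj₂ b)) (ℓ + ℓ) (y a) → y a ∈ X′
        to in-ball with y a ∈? X′ | mem-subset (λ a → does (y a ∈? X′)) a
        ... | yes ya∈ | _   = ya∈
        ... | no _    | out = contradiction in-ball (far a b out)

  -- Of N sampled centres, either p + 1 are pairwise more than 2ℓ apart or 2 ^ (m + m) are pairwise
  -- within 2ℓ. A second use of Ramsey's theorem leaves m centres at uniform distances, for the k +
  -- 1 rows and 2 ^ k columns of the grid. The product N * (N * (N * 2)) counts the triples with a
  -- choice of midpoint.
  heavy : ∀ k p N q → let m = suc k + 2 ^ k in 2 ^ (suc p + 2 ^ (m + m)) ≤ N → N * (N * (N * 2)) ≤ q →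
    (∀ S X → Shattered G S X → ∣ X ∣ < k) → (∀ C → Packing G ℓ C → ∣ C ∣ ≤ p) → Heavy ballᵇ (suc q)
  heavy k p N q N-large q-large dimension packing w W>0
    with Fin.any? (λ v → sum w ≤? suc q * sum λ c → w c * ind (ballᵇ c v))
  ... | yes found = found
  ... | no ¬found = conclude (ramsey (λ i j → ℓ + ℓ <? d (u i) (u j)) (λ {i} {j} → subst (ℓ + ℓ <_) (d-sym (u i) (u j))) (suc p) (2 ^ (m + m)) N-large)
    where
    m = suc k + 2 ^ k
    light : ∀ v → suc q * sum (λ c → w c * ind (ballᵇ c v)) ≤ sum w
    light v = <⇒≤ (≰⇒> λ le → ¬found (v , le))
    sampled = sample ballᵇ N 2 midpoint (suc q) (s≤s q-large) w W>0 light
    u : Fin N → V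
    u = lookup (proj₁ sampled)
    module _ (e : Fin (2 ^ (m + m)) → Fin N) (e-near : ∀ i j → i ≢ j → e i ≢ e j × ¬ (ℓ + ℓ < d (u (e i)) (u (e j)))) where
      grid : ∀ (g : Fin m → Fin (2 ^ (m + m))) → (∀ i j → i ≢ j → g i ≢ g j) →
        (∀ i j → i ≢ j → ℓ + ℓ ≤ d (u (e (g i))) (u (e (g j)))) ⊎ (∀ i j → i ≢ j → d (u (e (g i))) (u (e (g j))) < ℓ + ℓ) →
        Empty.⊥
      grid g g-injective uniform =
        let S , X , shattered , k≤ = grid⇒shattered k x (λ i j i≢j → ≮⇒≥ (proj₂ (e-near _ _ (distinct i≢j)))) avoid (uniformₓ uniform)
        in contradiction k≤ (<⇒≱ (dimension S X shattered))
        where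
        ι : Fin (suc k) ⊎ Fin (2 ^ k) → Fin m
        ι = join (suc k) (2 ^ k)
        ι-injective : ∀ {i j} → i ≢ j → ι i ≢ ι j
        ι-injective {i} {j} i≢j eq = i≢j (trans (sym (Fin.splitAt-join (suc k) (2 ^ k) i)) (trans (cong (splitAt (suc k)) eq) (Fin.splitAt-join (suc k) (2 ^ k) j)))
        distinct : ∀ {i j} → i ≢ j → g (ι i) ≢ g (ι j)
        distinct i≢j = g-injective _ _ (ι-injective i≢j)
        x : Fin (suc k) ⊎ Fin (2 ^ k) → V
        x i = u (e (g (ι i)))
        avoid : ∀ i j k s → k ≢ i → k ≢ j → ℓ < d (midpoint s (x i) (x j)) (x k)
        avoid i j k s k≢i k≢j = subst (ℓ <_) (d-sym (x k) (midpoint s (x i) (x j)))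
          (ballᵇ-false (proj₂ sampled _ _ _ s (proj₁ (e-near _ _ (distinct k≢i))) (proj₁ (e-near _ _ (distinct k≢j)))))
        uniformₓ : _ ⊎ _ → (∀ i j → i ≢ j → ℓ + ℓ ≤ d (x i) (x j)) ⊎ (∀ i j → i ≢ j → d (x i) (x j) < ℓ + ℓ)
        uniformₓ (inj₁ long)    = inj₁ λ i j i≢j → long _ _ (ι-injective i≢j)
        uniformₓ (inj₂ shorter) = inj₂ λ i j i≢j → shorter _ _ (ι-injective i≢j)
      clique : Empty.⊥
      clique = [ (λ { (g , pairs) → grid g (λ i j i≢j → proj₁ (pairs i j i≢j)) (inj₂ λ i j i≢j → proj₂ (pairs i j i≢j)) })
               , (λ { (g , pairs) → grid g (λ i j i≢j → proj₁ (pairs i j i≢j)) (inj₁ λ i j i≢j → ≮⇒≥ (proj₂ (pairs i j i≢j))) })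
               ]′ (ramsey (λ i j → d (u (e i)) (u (e j)) <? ℓ + ℓ) (λ {i} {j} → subst (_< ℓ + ℓ) (d-sym (u (e i)) (u (e j)))) m m ≤-refl)
    conclude : _ ⊎ _ → ∃ λ v → sum w ≤ suc q * sum λ c → w c * ind (ballᵇ c v)
    conclude (inj₁ (e , pairs)) =
      let C , is-packing , p< = far⇒packing (suc p) (u ∘ e) (λ i j i≢j → proj₂ (pairs i j i≢j))
      in contradiction p< (≤⇒≯ (packing C is-packing))
    conclude (inj₂ (e , pairs)) = Empty.⊥-elim (clique e pairs)

-- The covering bound

sampleSize : ℕ → ℕ → ℕ
sampleSize k p = let m = suc k + 2 ^ k in 2 ^ (suc p + 2 ^ (m + m))

coverSize : ℕ → ℕ → ℕ
coverSize p d = let N = sampleSize (suc d) p in hittingSize d (N * (N * (N * 2)))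

theorem11 : Σ (ℕ → ℕ → ℕ) λ f →
    ∀ (ℓ d : ℕ) (G : Graph) → DistVCDim G d →
    ∀ (p : ℕ) → PackingNumber G ℓ p →
    Σ (Subset (n G)) λ X → Transversal G ℓ X × ∣ X ∣ ≤ f p d
theorem11 = coverSize , λ ℓ d G (_ , dimension) p (_ , packing) →
  let open Balls G ℓ
      N = sampleSize (suc d) p
      -- The dimension bound enters twice: for `G` itself in the net, and for induced subgraphs in
      -- `heavy`.
      s , s≤ , g , hit = hittingSet ballᵇ d (N * (N * (N * 2)))
        (λ shatters → let X , shattered , d< = shatters⇒shattered (suc d) shatters in contradiction d< (≤⇒≯ (dimension ⊤ X shattered)))
        (heavy (suc d) p N (N * (N * (N * 2))) ≤-refl ≤-refl (λ S X shattered → s≤s (dimension S X shattered)) packing)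
  in image g , (λ v → let i , in-ball = hit v in g i , ∈-image g i , ballᵇ-sound in-ball) , ≤-trans (∣image∣≤ g) s≤
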